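{- Let $\mathcal{P}_4$ be the set of partitions $\lambda=(\lambda_1>\cdots>\lambda_\ell)$ into distinct positive parts such that for each $1\le i<\ell$: $\lambda_i-\lambda_{i+1}\equiv2\pmod 4$ if both are odd; $\equiv0\pmod 4$ if both are even; $\equiv3\pmod 4$ if they have different parity; and the smallest part $\lambda_\ell\equiv1$ or $2\pmod 4$ (empty partition included). Then $$\sum_{\lambda\in\mathcal{P}_4}(-1)^{o(\lambda)}q^{|\lambda|}=\sum_{n=0}^{\infty}\frac{(q;q^2)_{n}(-1)^nq^{n^{2}}}{(q^4;q^4)_{n}}=\frac{(q;q^6)_{\infty}(q^5;q^6)_{\infty}(q^6;q^{12})_{\infty}^{2}}{(q^2;q^6)_{\infty}(q^3;q^6)_{\infty}(q^4;q^6)_{\infty}}.$$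
   Context: $o(\lambda)$ is the number of odd parts of $\lambda$, $|\lambda|$ the sum of its parts, $(a;q)_n=\prod_{i=0}^{n-1}(1-aq^i)$ for $n\in\mathbb{Z}_{\ge0}\cup\{\infty\}$, $|q|<1$. -}

module Defs where

open import Data.Bool using (Bool; true; false; if_then_else_; _∧_; _∨_; not)
open import Data.Nat as ℕ using (ℕ; zero; suc; _≡ᵇ_; _<ᵇ_; _∸_; _%_)
open import Data.Integer as ℤ using (ℤ; +_; -_; 0ℤ; 1ℤ)
open import Data.List using (List; []; _∷_; _++_; map; foldr; filterᵇ; upTo)

-- Formal power series in q with integer coefficients, as coefficient
-- functions:  f n = coefficient of q^n.

Series : Set
Series = ℕ → ℤ

sumBelow : ℕ → (ℕ → ℤ) → ℤ
sumBelow zero    f = 0ℤ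
sumBelow (suc n) f = sumBelow n f ℤ.+ f n

mon : ℕ → Series
mon m k = if m ≡ᵇ k then 1ℤ else 0ℤ

one : Series
one = mon 0

_⊕_ : Series → Series → Series
(f ⊕ g) k = f k ℤ.+ g k

_⊖_ : Series → Series → Series
(f ⊖ g) k = f k ℤ.- g k

scale : ℤ → Series → Series
scale c f k = c ℤ.* f k

_⊛_ : Series → Series → Series
(f ⊛ g) n = sumBelow (suc n) (λ k → f k ℤ.* g (n ∸ k))

prodList : List Series → Series
prodList = foldr _⊛_ one

oneMinus : ℕ → Series
oneMinus m = one ⊖ mon m

-- 1/(1 - q^m) = Σ_{j ≥ 0} q^{m j}   (used only for m ≥ 1; for the
-- coefficient of q^k only j ≤ k can contribute)
geo : ℕ → Series
geo m k = sumBelow (suc k) (λ j → mon (m ℕ.* j) k)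

poch : ℕ → ℕ → ℕ → Series
poch a d n = prodList (map (λ i → oneMinus (a ℕ.+ d ℕ.* i)) (upTo n))

invPoch : ℕ → ℕ → ℕ → Series
invPoch a d n = prodList (map (λ i → geo (a ℕ.+ d ℕ.* i)) (upTo n))

-- (q^a ; q^d)_∞ for a ≥ 1, d ≥ 1: the coefficient of q^N stabilises once
-- N+1 factors are taken (all further factors are 1 + O(q^{N+1})).
pochInf : ℕ → ℕ → Series
pochInf a d N = poch a d (suc N) N

-- 1 / (q^a ; q^d)_∞ for a ≥ 1, d ≥ 1 (same truncation argument)
invPochInf : ℕ → ℕ → Series
invPochInf a d N = invPoch a d (suc N) N

-- Σ_{n ≥ 0} t n, for a family with t n = O(q^n): the coefficient of q^N
-- only receives contributions from n ≤ N.
sumInf : (ℕ → Series) → Series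
sumInf t N = sumBelow (suc N) (λ n → t n N)

negOnePow : ℕ → ℤ
negOnePow zero    = 1ℤ
negOnePow (suc n) = - negOnePow n

isOdd : ℕ → Bool
isOdd n = n % 2 ≡ᵇ 1

oddParts : List ℕ → ℕ
oddParts []       = 0
oddParts (x ∷ xs) = (if isOdd x then 1 else 0) ℕ.+ oddParts xs

size : List ℕ → ℕ
size []       = 0
size (x ∷ xs) = x ℕ.+ size xs

distinctParts≤ : ℕ → List (List ℕ)
distinctParts≤ zero    = [] ∷ []
distinctParts≤ (suc b) = distinctParts≤ b ++ map (suc b ∷_) (distinctParts≤ b)

consecutiveOK : ℕ → ℕ → Bool
consecutiveOK x y =
  (y <ᵇ x) ∧
  (if isOdd x ∧ isOdd y then (x ∸ y) % 4 ≡ᵇ 2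
   else if not (isOdd x) ∧ not (isOdd y) then (x ∸ y) % 4 ≡ᵇ 0
   else (x ∸ y) % 4 ≡ᵇ 3)

smallestOK : ℕ → Bool
smallestOK x = (x % 4 ≡ᵇ 1) ∨ (x % 4 ≡ᵇ 2)

inP4 : List ℕ → Bool
inP4 []                = true
inP4 (x ∷ [])          = (0 <ᵇ x) ∧ smallestOK x
inP4 (x ∷ rest@(y ∷ _)) = consecutiveOK x y ∧ inP4 rest

-- Σ_{λ ∈ 𝒫₄} (-1)^{o(λ)} q^{|λ|}: the coefficient of q^N sums over the
-- partitions in 𝒫₄ of size N (all have parts ≤ N).
P4Series : Series
P4Series N = sumList (filterᵇ (λ l → (size l ≡ᵇ N) ∧ inP4 l) (distinctParts≤ N))
  where
  sumList : List (List ℕ) → ℤ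
  sumList []       = 0ℤ
  sumList (l ∷ ls) = negOnePow (oddParts l) ℤ.+ sumList ls

middleSeries : Series
middleSeries = sumInf (λ n → poch 1 2 n ⊛ (scale (negOnePow n) (mon (n ℕ.* n)) ⊛ invPoch 4 4 n))

productSeries : Series
productSeries =
  pochInf 1 6 ⊛ (pochInf 5 6 ⊛ (pochInf 6 12 ⊛ (pochInf 6 12 ⊛
  (invPochInf 2 6 ⊛ (invPochInf 3 6 ⊛ invPochInf 4 6)))))

{-# OPTIONS --safe #-}

-- Coefficients up to q^N are computed in the ring ℤ[[q]]/(q^{N+1}), where q is nilpotent, so that every infinite sum
-- and product is a finite one.
--
-- Product side: by Gauss, 1/(q⁴;q⁴)_n = Σ_{|r| ≤ n} (-1)^r q^{2r²} / ((q²;q²)_{n-r} (q²;q²)_{n+r}). Inserting this and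
-- exchanging the sums, the inner sum over n equals (-1)^r q^{r²} (q;q²)_∞/(q²;q²)_∞ (Bailey), which leaves
-- (q;q²)_∞/(q²;q²)_∞ Σ_r q^{3r²}; the theta series is a product by the finite Jacobi triple product. All three
-- summations telescope.
--
-- Partition side: let L_k be the signed generating function of what may follow a largest part x in a partition of 𝒫₄;
-- it is the same for x = 2k+1 and x = 2k+2, and L_{k+2} = L_k + q^{2k+2} L_k - q^{2k+3} L_{k+1}. Hence
-- G(z) = Σ L_k z^k satisfies (1 - z²) G(z) = 1 - qz (1 - qz) G(q²z), and the sum over 𝒫₄ is 1 - q (1 - q) G(q²).
-- Iterating the functional equation produces the summands (q;q²)_n (-1)^n q^{n²} / (q⁴;q⁴)_n.
module Submission where

open import Defs
open import Algebra.Bundles using (CommutativeRing)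
import Algebra.Properties.AbelianGroup
import Algebra.Properties.Ring
import Algebra.Properties.Semiring.Exp
import Algebra.Properties.Semiring.Mult
import Algebra.Properties.Semiring.Mult.TCOptimised
import Algebra.Solver.Ring
open import Algebra.Solver.Ring.AlmostCommutativeRing using (fromCommutativeRing; _-Raw-AlmostCommutative⟶_)
open import Data.Bool using (Bool; true; false; if_then_else_; _∧_; not)
open import Data.Bool.Properties using (T-≡; ∧-identityʳ; ∧-zeroʳ)
open import Data.Integer as ℤ using (ℤ; +_; -[1+_]; 0ℤ; 1ℤ)
import Data.Integer.Properties as ℤ
import Data.Integer.Tactic.RingSolver as ℤRing
open import Data.List using (List; []; _∷_; _++_; map; foldr; filterᵇ; applyUpTo)
open import Data.Maybe using (Maybe; just; nothing)
open import Data.Nat as ℕ using (ℕ; zero; suc; s≤s; _<ᵇ_; _≡ᵇ_; _%_; _∸_)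
import Data.Nat.Properties as ℕ
open import Data.Nat.Tactic.RingSolver using (solve-∀)
open import Data.Product using (_,_; _×_; proj₁; proj₂)
open import Data.Sum using ([_,_]′)
open import Function using (_∘_; Equivalence; id)
open import Level using (0ℓ)
open import Relation.Binary.PropositionalEquality as ≡ using (_≡_)
import Relation.Binary.Reasoning.Setoid
open import Relation.Nullary using (yes; no)

-- Ring solver with integer coefficients, and finite sums

-- The identities are proved in an arbitrary commutative ring, and q^(N+1) = 0 is assumed only where
-- infinite sums or products occur; the concrete ring of series enters at the end. A nilpotent q has
-- no inverse, and this shapes the formulas. Inverse factorials are elements with a recurrence of
-- their own, a quotient such as Q^(n-r)/(Q;Q)_(n-r) is a separate function tied to the others by a
-- multiplied-out relation, and common powers of q are taken out of exponents before summing. Limits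
-- become evaluations at a large enough index, N or 2N. Bilateral sums have summands even in r, so
-- they are folded into the term r = 0 and twice the terms r ≥ 1. Each telescoping rests on an
-- explicit certificate; once the powers of q involved are treated as independent variables,
-- checking it is a polynomial identity with integer coefficients, which is why a ring solver over
-- an arbitrary ring comes first.

module IntegerSolver {c ℓ} (R : CommutativeRing c ℓ) where
  open CommutativeRing R
  open Algebra.Properties.Ring ring
  open Algebra.Properties.AbelianGroup +-abelianGroup using (⁻¹-∙-comm)
  open Algebra.Properties.Semiring.Mult semiring using (×1-homo-*; ×-homo-+) renaming (_×_ to _×ᵤ_)
  open Algebra.Properties.Semiring.Mult.TCOptimised semiring using () renaming (_×_ to _×′_; ×ᵤ≈× to ×ᵤ≈×′)
  open Relation.Binary.Reasoning.Setoid setoid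

  -- The optimised multiples make 0 and 1 evaluate to `0#` and `1#` by computation, so that `con 0ℤ`
  -- and `con 1ℤ` match the constants occurring in goals. The homomorphism laws are proved through
  -- the plain multiples `×ᵤ`.
  ⟦_⟧ : ℤ → Carrier
  ⟦ + n ⟧      = n ×′ 1#
  ⟦ -[1+ n ] ⟧ = - (suc n ×′ 1#)

  ⟦+⟧ : ∀ n → ⟦ + n ⟧ ≈ n ×ᵤ 1#
  ⟦+⟧ n = sym (×ᵤ≈×′ n 1#)

  ⟦-⟧ : ∀ n → ⟦ ℤ.- (+ n) ⟧ ≈ - (n ×ᵤ 1#)
  ⟦-⟧ zero    = sym -0#≈0#
  ⟦-⟧ (suc n) = -‿cong (⟦+⟧ (suc n))

  -‿homo : ∀ i → ⟦ ℤ.- i ⟧ ≈ - ⟦ i ⟧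
  -‿homo (+ n)    = trans (⟦-⟧ n) (-‿cong (sym (⟦+⟧ n)))
  -‿homo -[1+ n ] = sym (-‿involutive _)

  a+b-[a+d] : ∀ a b d → (a + b) - (a + d) ≈ b - d
  a+b-[a+d] a b d = begin
    (a + b) - (a + d)     ≈⟨ +-congˡ (⁻¹-∙-comm a d) ⟨
    (a + b) + (- a - d)   ≈⟨ +-congʳ (+-comm a b) ⟩
    (b + a) + (- a - d)   ≈⟨ +-assoc b a _ ⟩
    b + (a + (- a - d))   ≈⟨ +-congˡ (+-assoc a (- a) (- d)) ⟨
    b + ((a - a) - d)     ≈⟨ +-congˡ (+-congʳ (-‿inverseʳ a)) ⟩
    b + (0# - d)          ≈⟨ +-congˡ (+-identityˡ _) ⟩
    b - d                 ∎

  ⊖-homo : ∀ m n → ⟦ m ℤ.⊖ n ⟧ ≈ m ×ᵤ 1# - n ×ᵤ 1#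
  ⊖-homo zero zero = sym (-‿inverseʳ 0#)
  ⊖-homo zero (suc n) = trans (⟦-⟧ (suc n)) (sym (+-identityˡ _))
  ⊖-homo (suc m) zero = begin
    ⟦ + suc m ⟧         ≈⟨ ⟦+⟧ (suc m) ⟩
    suc m ×ᵤ 1#          ≈⟨ +-identityʳ _ ⟨
    suc m ×ᵤ 1# + 0#     ≈⟨ +-congˡ -0#≈0# ⟨
    suc m ×ᵤ 1# - 0#     ∎
  ⊖-homo (suc m) (suc n) = begin
    ⟦ suc m ℤ.⊖ suc n ⟧       ≡⟨ ≡.cong ⟦_⟧ (ℤ.[1+m]⊖[1+n]≡m⊖n m n) ⟩
    ⟦ m ℤ.⊖ n ⟧               ≈⟨ ⊖-homo m n ⟩
    m ×ᵤ 1# - n ×ᵤ 1#           ≈⟨ a+b-[a+d] 1# _ _ ⟨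
    suc m ×ᵤ 1# - suc n ×ᵤ 1#   ∎

  +-homo : ∀ i j → ⟦ i ℤ.+ j ⟧ ≈ ⟦ i ⟧ + ⟦ j ⟧
  +-homo (+ m) (+ n) = trans (⟦+⟧ (m ℕ.+ n)) (trans (×-homo-+ 1# m n) (sym (+-cong (⟦+⟧ m) (⟦+⟧ n))))
  +-homo (+ m) -[1+ n ] = trans (⊖-homo m (suc n)) (sym (+-cong (⟦+⟧ m) (⟦-⟧ (suc n))))
  +-homo -[1+ m ] (+ n) = trans (⊖-homo n (suc m)) (trans (+-comm _ _) (sym (+-cong (⟦-⟧ (suc m)) (⟦+⟧ n))))
  +-homo -[1+ m ] -[1+ n ] = begin
    ⟦ -[1+ suc (m ℕ.+ n) ] ⟧          ≡⟨ ≡.cong (λ k → ⟦ -[1+ k ] ⟧) (ℕ.+-suc m n) ⟨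
    ⟦ -[1+ m ℕ.+ suc n ] ⟧            ≈⟨ ⟦-⟧ (suc m ℕ.+ suc n) ⟩
    - ((suc m ℕ.+ suc n) ×ᵤ 1#)        ≈⟨ -‿cong (×-homo-+ 1# (suc m) (suc n)) ⟩
    - (suc m ×ᵤ 1# + suc n ×ᵤ 1#)       ≈⟨ ⁻¹-∙-comm _ _ ⟨
    - (suc m ×ᵤ 1#) - suc n ×ᵤ 1#       ≈⟨ +-cong (⟦-⟧ (suc m)) (⟦-⟧ (suc n)) ⟨
    ⟦ -[1+ m ] ⟧ + ⟦ -[1+ n ] ⟧       ∎

  *-homo-ℕ : ∀ m j → ⟦ + m ℤ.* j ⟧ ≈ ⟦ + m ⟧ * ⟦ j ⟧
  *-homo-ℕ m (+ n) = begin
    ⟦ + m ℤ.* + n ⟧         ≡⟨ ≡.cong ⟦_⟧ (ℤ.pos-* m n) ⟨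
    ⟦ + (m ℕ.* n) ⟧         ≈⟨ ⟦+⟧ (m ℕ.* n) ⟩
    (m ℕ.* n) ×ᵤ 1#          ≈⟨ ×1-homo-* m n ⟩
    (m ×ᵤ 1#) * (n ×ᵤ 1#)     ≈⟨ *-cong (⟦+⟧ m) (⟦+⟧ n) ⟨
    ⟦ + m ⟧ * ⟦ + n ⟧       ∎
  *-homo-ℕ m -[1+ n ] = begin
    ⟦ + m ℤ.* -[1+ n ] ⟧          ≡⟨ ≡.cong ⟦_⟧ (ℤ.neg-distribʳ-* (+ m) (+ suc n)) ⟨
    ⟦ ℤ.- (+ m ℤ.* + suc n) ⟧     ≈⟨ -‿homo (+ m ℤ.* + suc n) ⟩
    - ⟦ + m ℤ.* + suc n ⟧         ≈⟨ -‿cong (*-homo-ℕ m (+ suc n)) ⟩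
    - (⟦ + m ⟧ * ⟦ + suc n ⟧)     ≈⟨ -‿distribʳ-* _ _ ⟩
    ⟦ + m ⟧ * ⟦ -[1+ n ] ⟧        ∎

  *-homo : ∀ i j → ⟦ i ℤ.* j ⟧ ≈ ⟦ i ⟧ * ⟦ j ⟧
  *-homo (+ m) j = *-homo-ℕ m j
  *-homo -[1+ m ] j = begin
    ⟦ -[1+ m ] ℤ.* j ⟧          ≡⟨ ≡.cong ⟦_⟧ (ℤ.neg-distribˡ-* (+ suc m) j) ⟨
    ⟦ ℤ.- (+ suc m ℤ.* j) ⟧     ≈⟨ -‿homo (+ suc m ℤ.* j) ⟩
    - ⟦ + suc m ℤ.* j ⟧         ≈⟨ -‿cong (*-homo-ℕ (suc m) j) ⟩
    - (⟦ + suc m ⟧ * ⟦ j ⟧)     ≈⟨ -‿distribˡ-* _ _ ⟩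
    ⟦ -[1+ m ] ⟧ * ⟦ j ⟧        ∎

  morphism : ℤ.+-*-rawRing -Raw-AlmostCommutative⟶ fromCommutativeRing R
  morphism = record
    { ⟦_⟧ = ⟦_⟧ ; +-homo = +-homo ; *-homo = *-homo ; -‿homo = -‿homo
    ; 0-homo = refl ; 1-homo = refl }

  ⟦⟧-≟ : ∀ i j → Maybe (⟦ i ⟧ ≈ ⟦ j ⟧)
  ⟦⟧-≟ i j with i ℤ.≟ j
  ... | yes ≡.refl = just refl
  ... | no  _      = nothing

  open Algebra.Solver.Ring ℤ.+-*-rawRing (fromCommutativeRing R) morphism ⟦⟧-≟ public
    using (solve; _:=_; _:+_; _:*_; _:-_; :-_; con)

module FiniteSums {c ℓ} (R : CommutativeRing c ℓ) where
  open CommutativeRing R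
  open IntegerSolver R

  Σ< : ℕ → (ℕ → Carrier) → Carrier
  Σ< zero    f = 0#
  Σ< (suc n) f = Σ< n f + f n

  Π< : ℕ → (ℕ → Carrier) → Carrier
  Π< zero    f = 1#
  Π< (suc n) f = Π< n f * f n

  Σ-cong< : ∀ n {f g} → (∀ {k} → k ℕ.< n → f k ≈ g k) → Σ< n f ≈ Σ< n g
  Σ-cong< zero    eq = refl
  Σ-cong< (suc n) eq = +-cong (Σ-cong< n (λ k<n → eq (ℕ.m<n⇒m<1+n k<n))) (eq ℕ.≤-refl)

  Σ-cong : ∀ n {f g} → (∀ k → f k ≈ g k) → Σ< n f ≈ Σ< n g
  Σ-cong n eq = Σ-cong< n (λ {k} _ → eq k)

  Π-cong : ∀ n {f g} → (∀ k → f k ≈ g k) → Π< n f ≈ Π< n g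
  Π-cong zero    eq = refl
  Π-cong (suc n) eq = *-cong (Π-cong n eq) (eq n)

  Σ-0< : ∀ n {f} → (∀ {k} → k ℕ.< n → f k ≈ 0#) → Σ< n f ≈ 0#
  Σ-0< zero    eq = refl
  Σ-0< (suc n) eq = trans (+-cong (Σ-0< n (λ k<n → eq (ℕ.m<n⇒m<1+n k<n))) (eq ℕ.≤-refl)) (+-identityˡ 0#)

  Σ-0 : ∀ n {f} → (∀ k → f k ≈ 0#) → Σ< n f ≈ 0#
  Σ-0 n eq = Σ-0< n (λ {k} _ → eq k)

  Σ-+ : ∀ n f g → Σ< n (λ k → f k + g k) ≈ Σ< n f + Σ< n g
  Σ-+ zero    f g = sym (+-identityˡ 0#)
  Σ-+ (suc n) f g = trans (+-congʳ (Σ-+ n f g))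
    (solve 4 (λ a b x y → (a :+ b) :+ (x :+ y) := (a :+ x) :+ (b :+ y)) refl _ _ _ _)

  Σ-*ˡ : ∀ n a f → Σ< n (λ k → a * f k) ≈ a * Σ< n f
  Σ-*ˡ zero    a f = sym (zeroʳ a)
  Σ-*ˡ (suc n) a f = trans (+-congʳ (Σ-*ˡ n a f)) (sym (distribˡ a _ _))

  Π-* : ∀ n f g → Π< n (λ k → f k * g k) ≈ Π< n f * Π< n g
  Π-* zero    f g = sym (*-identityˡ 1#)
  Π-* (suc n) f g = trans (*-congʳ (Π-* n f g))
    (solve 4 (λ a b x y → (a :* b) :* (x :* y) := (a :* x) :* (b :* y)) refl _ _ _ _)

  Π-1 : ∀ n {f} → (∀ k → f k ≈ 1#) → Π< n f ≈ 1#
  Π-1 zero    eq = refl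
  Π-1 (suc n) eq = trans (*-cong (Π-1 n eq) (eq n)) (*-identityˡ 1#)

  Σ-swap : ∀ m n (f : ℕ → ℕ → Carrier) → Σ< m (λ i → Σ< n (f i)) ≈ Σ< n (λ j → Σ< m (λ i → f i j))
  Σ-swap zero    n f = sym (Σ-0 n (λ _ → refl))
  Σ-swap (suc m) n f = trans (+-congʳ (Σ-swap m n f)) (sym (Σ-+ n _ _))

  Σ-split : ∀ m n f → Σ< (n ℕ.+ m) f ≈ Σ< m f + Σ< n (λ k → f (k ℕ.+ m))
  Σ-split m zero    f = sym (+-identityʳ _)
  Σ-split m (suc n) f = trans (+-congʳ (Σ-split m n f)) (+-assoc _ _ _)

  Π-split : ∀ m n f → Π< (n ℕ.+ m) f ≈ Π< m f * Π< n (λ k → f (k ℕ.+ m))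
  Π-split m zero    f = sym (*-identityʳ _)
  Π-split m (suc n) f = trans (*-congʳ (Π-split m n f)) (*-assoc _ _ _)

  Σ-front : ∀ n f → Σ< (suc n) f ≈ f 0 + Σ< n (f ∘ suc)
  Σ-front zero    f = trans (+-identityˡ _) (sym (+-identityʳ _))
  Σ-front (suc n) f = trans (+-congʳ (Σ-front n f)) (+-assoc _ _ _)

  Π-front : ∀ n f → Π< (suc n) f ≈ f 0 * Π< n (f ∘ suc)
  Π-front zero    f = trans (*-identityˡ _) (sym (*-identityʳ _))
  Π-front (suc n) f = trans (*-congʳ (Π-front n f)) (*-assoc _ _ _)

  Σ-telescope : ∀ n {f} (e : ℕ → Carrier) → (∀ k → f k ≈ e k - e (suc k)) → Σ< n f ≈ e 0 - e n
  Σ-telescope zero    e eq = sym (-‿inverseʳ (e 0))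
  Σ-telescope (suc n) e eq = trans (+-cong (Σ-telescope n e eq) (eq n))
    (solve 3 (λ a b x → (a :- b) :+ (b :- x) := a :- x) refl _ _ _)

  Σ-extend : ∀ m n {f} → (∀ k → f (k ℕ.+ m) ≈ 0#) → Σ< (n ℕ.+ m) f ≈ Σ< m f
  Σ-extend m n eq = trans (Σ-split m n _) (trans (+-congˡ (Σ-0 n eq)) (+-identityʳ _))

  Π-extend : ∀ m n {f} → (∀ k → f (k ℕ.+ m) ≈ 1#) → Π< (n ℕ.+ m) f ≈ Π< m f
  Π-extend m n eq = trans (Π-split m n _) (trans (*-congˡ (Π-1 n eq)) (*-identityʳ _))

  -- Some certificates hold only modulo a relation x ≈ y that cannot be solved for one of its
  -- factors. The polynomial identity then carries an explicit multiple of x - y, which is discarded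
  -- here.
  *-[x≈y] : ∀ {x y} c → x ≈ y → c * (x - y) ≈ 0#
  *-[x≈y] {x} {y} c eq = trans (*-congˡ (trans (+-congʳ eq) (-‿inverseʳ y))) (zeroʳ c)

-- Telescoping bilateral sums

module SymmetricSums {c ℓ} (R : CommutativeRing c ℓ) where
  open CommutativeRing R
  open FiniteSums R
  open IntegerSolver R
  open Algebra.Properties.Ring ring
  open Algebra.Properties.Semiring.Exp semiring using (_^_; ^-homo-*)
  open Relation.Binary.Reasoning.Setoid setoid

  -- D n plays the role of 1/(Q;Q)_n, and Dsub n r that of 1/(Q;Q)_{n-r}, which vanishes for r > n;
  -- QDsub n r is Q^{n-r}/(Q;Q)_{n-r}.
  module InverseFactorials (Q : Carrier) (D : ℕ → Carrier) (D0 : D 0 ≈ 1#)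
    (D-step : ∀ n → D n ≈ (1# - Q ^ suc n) * D (suc n)) where

    Dsub : ℕ → ℕ → Carrier
    Dsub n       zero    = D n
    Dsub zero    (suc r) = 0#
    Dsub (suc n) (suc r) = Dsub n r

    Dsub-+ : ∀ m r → Dsub (m ℕ.+ r) r ≡ D m
    Dsub-+ m zero    = ≡.cong D (ℕ.+-identityʳ m)
    Dsub-+ m (suc r) = ≡.trans (≡.cong (λ k → Dsub k (suc r)) (ℕ.+-suc m r)) (Dsub-+ m r)

    Dsub-< : ∀ {n r} → n ℕ.< r → Dsub n r ≡ 0#
    Dsub-< {zero}  (s≤s _)   = ≡.refl
    Dsub-< {suc n} (s≤s n<r) = Dsub-< n<r

    QDsub : ℕ → ℕ → Carrier
    QDsub n       zero    = Q ^ n * D n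
    QDsub zero    (suc r) = 0#
    QDsub (suc n) (suc r) = QDsub n r

    -- The recurrence of `D` read at n - r. At the edge r = n + 1 it survives because the factor 1 -
    -- Q^0 is zero.
    Dsub-step : ∀ n r → Dsub n r ≈ Dsub (suc n) r - QDsub (suc n) r
    Dsub-step n zero = trans (D-step n)
      (solve 2 (λ u d → (con 1ℤ :- u) :* d := d :- u :* d) refl _ _)
    Dsub-step zero (suc zero) =
      solve 1 (λ d → con 0ℤ := d :- con 1ℤ :* d) refl _
    Dsub-step zero (suc (suc r)) = sym (-‿inverseʳ 0#)
    Dsub-step (suc n) (suc r) = Dsub-step n r

    -- Q need not be invertible, so this multiplied-out relation replaces the division by Q^r. For r
    -- > n both sides vanish.
    Q^r*QDsub : ∀ n r → Q ^ r * QDsub n r ≈ Q ^ n * Dsub n r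
    Q^r*QDsub n       zero    = *-identityˡ _
    Q^r*QDsub zero    (suc r) = trans (zeroʳ _) (sym (zeroʳ _))
    Q^r*QDsub (suc n) (suc r) =
      trans (*-assoc _ _ _) (trans (*-congˡ (Q^r*QDsub n r)) (sym (*-assoc _ _ _)))

    -- Σ_{|r| ≤ M} a_{|r|} / ((Q)_{n-r} (Q)_{n+r})
    Θ : (ℕ → Carrier) → ℕ → ℕ → Carrier
    Θ a M n = a 0 * Dsub n 0 * D (n ℕ.+ 0)
            + (1# + 1#) * Σ< M (λ r → a (suc r) * Dsub n (suc r) * D (n ℕ.+ suc r))

    Θ0 : ∀ a M → a 0 ≈ 1# → Θ a M 0 ≈ 1#
    Θ0 a M a0 = begin
      a 0 * D 0 * D 0 + (1# + 1#) * Σ< M (λ r → a (suc r) * 0# * D (suc r))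
        ≈⟨ +-cong (*-cong (*-cong a0 D0) D0)
                  (*-congˡ (Σ-0 M (λ r → trans (*-congʳ (zeroʳ _)) (zeroˡ _)))) ⟩
      1# * 1# * 1# + (1# + 1#) * 0#
        ≈⟨ solve 0 (con 1ℤ :* con 1ℤ :* con 1ℤ :+ (con 1ℤ :+ con 1ℤ) :* con 0ℤ := con 1ℤ) refl ⟩
      1# ∎

    -- The folded sum of the differences is (e 0 - e 1) + 2 (e 1 - e (M + 1)). Evenness of the
    -- summand under r → -r shows up as the antisymmetry e (1 - r) = - e r of the certificate; its
    -- instance e 1 = - e 0 makes the total vanish.
    Θ-telescope : ∀ a M n α β (e : ℕ → Carrier) →
      (∀ r → α * (a r * Dsub (suc n) r * D (suc n ℕ.+ r)) - β * (a r * Dsub n r * D (n ℕ.+ r)) ≈ e r - e (suc r)) →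
      e 1 ≈ - e 0 → e (suc M) ≈ 0# → α * Θ a M (suc n) ≈ β * Θ a M n
    Θ-telescope a M n α β e term e1 eM = begin
      α * (S₀ + (1# + 1#) * S₊)
        ≈⟨ solve 6 (λ α β s t s' t' → α :* (s :+ (con 1ℤ :+ con 1ℤ) :* t)
             := β :* (s' :+ (con 1ℤ :+ con 1ℤ) :* t')
                :+ ((α :* s :- β :* s') :+ (con 1ℤ :+ con 1ℤ) :* (α :* t :+ (:- β) :* t')))
             refl α β S₀ S₊ T₀ T₊ ⟩
      β * Θ a M n + ((α * S₀ - β * T₀) + (1# + 1#) * (α * S₊ + (- β) * T₊))
        ≈⟨ +-congˡ (+-cong (term 0) (*-congˡ sums)) ⟩
      β * Θ a M n + ((e 0 - e 1) + (1# + 1#) * (e 1 - e (suc M)))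
        ≈⟨ +-congˡ (+-cong (+-congˡ (-‿cong e1)) (*-congˡ (+-cong e1 (-‿cong eM)))) ⟩
      β * Θ a M n + ((e 0 - - e 0) + (1# + 1#) * (- e 0 - 0#))
        ≈⟨ solve 2 (λ x e → x :+ ((e :- :- e) :+ (con 1ℤ :+ con 1ℤ) :* (:- e :- con 0ℤ)) := x) refl _ _ ⟩
      β * Θ a M n ∎
      where
      s t : ℕ → Carrier
      s r = a r * Dsub (suc n) r * D (suc n ℕ.+ r)
      t r = a r * Dsub n r * D (n ℕ.+ r)
      S₀ S₊ T₀ T₊ : Carrier
      S₀ = s 0
      T₀ = t 0
      S₊ = Σ< M (s ∘ suc)
      T₊ = Σ< M (t ∘ suc)
      sums : α * S₊ + (- β) * T₊ ≈ e 1 - e (suc M)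
      sums = begin
        α * S₊ + (- β) * T₊
          ≈⟨ +-cong (Σ-*ˡ M α _) (Σ-*ˡ M (- β) _) ⟨
        Σ< M (λ r → α * s (suc r)) + Σ< M (λ r → (- β) * t (suc r))
          ≈⟨ Σ-+ M _ _ ⟨
        Σ< M (λ r → α * s (suc r) + (- β) * t (suc r))
          ≈⟨ Σ-telescope M (e ∘ suc) (λ r → trans (+-congˡ (sym (-‿distribˡ-* β _))) (term (suc r))) ⟩
        e 1 - e (suc M) ∎

    D-step+ : ∀ n r → D (n ℕ.+ r) ≈ (1# - Q * (Q ^ r * Q ^ n)) * D (suc n ℕ.+ r)
    D-step+ n r = trans (D-step (n ℕ.+ r))
      (*-congʳ (+-congˡ (-‿cong (*-congˡ (trans (^-homo-* Q n r) (*-comm _ _))))))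

    D-shift : ∀ n r → D (n ℕ.+ suc r) ≈ D (suc n ℕ.+ r)
    D-shift n r = reflexive (≡.cong D (ℕ.+-suc n r))

    -- Gauss' sum a_r = (-1)^r Q^{r²}: Θ is 1/(Q²;Q²)_n up to Θ_0.
    Θ-gauss : ∀ a M → (∀ r → a (suc r) ≈ - (Q * (Q ^ r * Q ^ r)) * a r) → a 0 ≈ 1# → a (suc M) ≈ 0# →
              ∀ n → (1# - Q ^ suc n * Q ^ suc n) * Θ a M (suc n) ≈ Θ a M n
    Θ-gauss a M a-step a0 aM n = trans (Θ-telescope a M n _ 1# e term e1 eM) (*-identityˡ _)
      where
      -- Over the common denominator (Q;Q)_(n+1-r) (Q;Q)_(n+1+r) the difference to be telescoped
      -- has, besides a_r, the numerator Q^(n+1-r) + Q^(n+1+r) - 2 Q^(2n+2). The certificate takes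
      -- the half Q^(n+1-r) (1 - Q^(n+1+r)); the other half, its image under r → -r, is - e (r + 1).
      e : ℕ → Carrier
      e r = a r * QDsub (suc n) r * D (n ℕ.+ r)
      eM : e (suc M) ≈ 0#
      eM = trans (*-congʳ (trans (*-congʳ aM) (zeroˡ _))) (zeroˡ _)
      e-suc : ∀ r → e (suc r) ≈ - (Q * Q ^ r * (a r * (Q ^ n * Dsub n r) * D (suc n ℕ.+ r)))
      e-suc r = begin
        a (suc r) * QDsub n r * D (n ℕ.+ suc r)
          ≈⟨ *-cong (*-congʳ (a-step r)) (D-shift n r) ⟩
        - (Q * (Q ^ r * Q ^ r)) * a r * QDsub n r * D (suc n ℕ.+ r)
          ≈⟨ solve 5 (λ Q v a z d → (:- (Q :* (v :* v))) :* a :* z :* d := :- (Q :* v :* (a :* (v :* z) :* d)))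
               refl _ _ _ _ _ ⟩
        - (Q * Q ^ r * (a r * (Q ^ r * QDsub n r) * D (suc n ℕ.+ r)))
          ≈⟨ -‿cong (*-congˡ (*-congʳ (*-congˡ (Q^r*QDsub n r)))) ⟩
        - (Q * Q ^ r * (a r * (Q ^ n * Dsub n r) * D (suc n ℕ.+ r))) ∎
      e1 : e 1 ≈ - e 0
      e1 = begin
        e 1 ≈⟨ e-suc 0 ⟩
        - (Q * 1# * (a 0 * (Q ^ n * D n) * D (suc n ℕ.+ 0)))
          ≈⟨ -‿cong (*-congˡ (*-cong (*-congˡ (*-congˡ (reflexive (≡.cong D (≡.sym (ℕ.+-identityʳ n))))))
                                      (reflexive (≡.cong D (ℕ.+-identityʳ (suc n)))))) ⟩
        - (Q * 1# * (a 0 * (Q ^ n * D (n ℕ.+ 0)) * D (suc n)))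
          ≈⟨ solve 5 (λ Q a w d d' → :- (Q :* con 1ℤ :* (a :* (w :* d) :* d')) := :- (a :* ((Q :* w) :* d') :* d))
               refl _ _ _ _ _ ⟩
        - e 0 ∎
      term : ∀ r → (1# - Q ^ suc n * Q ^ suc n) * (a r * Dsub (suc n) r * D (suc n ℕ.+ r))
                   - 1# * (a r * Dsub n r * D (n ℕ.+ r)) ≈ e r - e (suc r)
      term r = begin
        (1# - (Q * Q ^ n) * (Q * Q ^ n)) * (a r * s * d) - 1# * (a r * Dsub n r * D (n ℕ.+ r))
          ≈⟨ +-congˡ (-‿cong (*-congˡ (*-cong (*-congˡ (Dsub-step n r)) (D-step+ n r)))) ⟩
        (1# - (Q * Q ^ n) * (Q * Q ^ n)) * (a r * s * d) - 1# * (a r * (s - x) * ((1# - Q * (Q ^ r * Q ^ n)) * d))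
          ≈⟨ solve 7 (λ Q v w s x d a →
               (con 1ℤ :- (Q :* w) :* (Q :* w)) :* (a :* s :* d)
                 :- con 1ℤ :* (a :* (s :- x) :* ((con 1ℤ :- Q :* (v :* w)) :* d))
               := (a :* x :* ((con 1ℤ :- Q :* (v :* w)) :* d) :+ Q :* v :* (a :* (w :* (s :- x)) :* d))
                  :+ a :* d :* Q :* w :* (v :* x :- (Q :* w) :* s))
               refl Q (Q ^ r) (Q ^ n) s x d (a r) ⟩
        (a r * x * ((1# - Q * (Q ^ r * Q ^ n)) * d) + Q * Q ^ r * (a r * (Q ^ n * (s - x)) * d))
          + a r * d * Q * Q ^ n * (Q ^ r * x - Q ^ suc n * s)
          ≈⟨ +-congˡ (*-[x≈y] _ (Q^r*QDsub (suc n) r)) ⟩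
        (a r * x * ((1# - Q * (Q ^ r * Q ^ n)) * d) + Q * Q ^ r * (a r * (Q ^ n * (s - x)) * d)) + 0#
          ≈⟨ +-identityʳ _ ⟩
        a r * x * ((1# - Q * (Q ^ r * Q ^ n)) * d) + Q * Q ^ r * (a r * (Q ^ n * (s - x)) * d)
          ≈⟨ +-cong (*-congˡ (D-step+ n r)) (*-congˡ (*-congʳ (*-congˡ (*-congˡ (Dsub-step n r))))) ⟨
        e r + Q * Q ^ r * (a r * (Q ^ n * Dsub n r) * d)
          ≈⟨ +-congˡ (-‿involutive _) ⟨
        e r - - (Q * Q ^ r * (a r * (Q ^ n * Dsub n r) * d))
          ≈⟨ +-congˡ (-‿cong (e-suc r)) ⟨
        e r - e (suc r) ∎
        where
        s x d : Carrier
        s = Dsub (suc n) r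
        x = QDsub (suc n) r
        d = D (suc n ℕ.+ r)

    -- The finite triple product a_r = t^{r²}, Q = t².
    Θ-jacobi : ∀ a M t → t * t ≈ Q → (∀ r → a (suc r) ≈ (t * Q ^ r) * a r) → a 0 ≈ 1# → a (suc M) ≈ 0# →
               ∀ n → ((1# - Q ^ suc n * Q ^ suc n) * (1# - t * Q ^ n)) * Θ a M (suc n) ≈ (1# + t * Q ^ n) * Θ a M n
    Θ-jacobi a M t t²≈Q a-step a0 aM n = Θ-telescope a M n _ _ e term e1 eM
      where
      y : Carrier
      y = t * Q ^ n
      Q* : ∀ z → Q * z ≈ t * t * z
      Q* z = *-congʳ (sym t²≈Q)
      -- Here the numerator is (1 + y) (Q^(n+1-r) + Q^(n+1+r)) - 2y - 2 Q^(2n+2). It is the sum of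
      -- (Q^(n+1-r) - y) (1 - Q^(n+1+r)), which is e r, and its image under r → -r, which is - e (r
      -- + 1) because t y = Q^(n+1).
      e : ℕ → Carrier
      e r = a r * (QDsub (suc n) r - y * Dsub (suc n) r) * D (n ℕ.+ r)
      eM : e (suc M) ≈ 0#
      eM = trans (*-congʳ (trans (*-congʳ aM) (zeroˡ _))) (zeroˡ _)
      e-suc : ∀ r → e (suc r) ≈ y * (1# - t * Q ^ r) * (a r * Dsub n r * D (suc n ℕ.+ r))
      e-suc r = begin
        a (suc r) * (QDsub n r - y * Dsub n r) * D (n ℕ.+ suc r)
          ≈⟨ *-cong (*-congʳ (a-step r)) (D-shift n r) ⟩
        (t * Q ^ r) * a r * (QDsub n r - y * Dsub n r) * D (suc n ℕ.+ r)
          ≈⟨ solve 7 (λ t v a z y s d → (t :* v) :* a :* (z :- y :* s) :* d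
               := (t :* (v :* z) :- t :* v :* y :* s) :* a :* d) refl t (Q ^ r) (a r) _ y _ _ ⟩
        (t * (Q ^ r * QDsub n r) - t * Q ^ r * y * Dsub n r) * a r * D (suc n ℕ.+ r)
          ≈⟨ *-congʳ (*-congʳ (+-congʳ (*-congˡ (Q^r*QDsub n r)))) ⟩
        (t * (Q ^ n * Dsub n r) - t * Q ^ r * y * Dsub n r) * a r * D (suc n ℕ.+ r)
          ≈⟨ solve 6 (λ t v w a s d → (t :* (w :* s) :- t :* v :* (t :* w) :* s) :* a :* d
               := t :* w :* (con 1ℤ :- t :* v) :* (a :* s :* d)) refl t (Q ^ r) (Q ^ n) (a r) _ _ ⟩
        y * (1# - t * Q ^ r) * (a r * Dsub n r * D (suc n ℕ.+ r)) ∎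
      e1 : e 1 ≈ - e 0
      e1 = begin
        e 1 ≈⟨ e-suc 0 ⟩
        y * (1# - t * 1#) * (a 0 * D n * D (suc n ℕ.+ 0))
          ≈⟨ *-congˡ (*-cong (*-congˡ (reflexive (≡.cong D (≡.sym (ℕ.+-identityʳ n)))))
                                      (reflexive (≡.cong D (ℕ.+-identityʳ (suc n))))) ⟩
        y * (1# - t * 1#) * (a 0 * D (n ℕ.+ 0) * D (suc n))
          ≈⟨ solve 5 (λ t w a d d' → t :* w :* (con 1ℤ :- t :* con 1ℤ) :* (a :* d :* d')
               := :- (a :* ((t :* t :* w) :* d' :- (t :* w) :* d') :* d))
               refl t (Q ^ n) _ _ _ ⟩
        - (a 0 * ((t * t * Q ^ n) * D (suc n) - y * D (suc n)) * D (n ℕ.+ 0))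
          ≈⟨ -‿cong (*-congʳ (*-congˡ (+-congʳ (*-congʳ (Q* _))))) ⟨
        - e 0 ∎
      term : ∀ r → ((1# - Q ^ suc n * Q ^ suc n) * (1# - y)) * (a r * Dsub (suc n) r * D (suc n ℕ.+ r))
                   - (1# + y) * (a r * Dsub n r * D (n ℕ.+ r)) ≈ e r - e (suc r)
      term r = begin
        ((1# - Q ^ suc n * Q ^ suc n) * (1# - y)) * (a r * s * d) - (1# + y) * (a r * Dsub n r * D (n ℕ.+ r))
          ≈⟨ +-cong (*-congʳ (*-congʳ (+-congˡ (-‿cong (*-cong (Q* _) (Q* _))))))
                    (-‿cong (*-congˡ (*-cong (*-congˡ (Dsub-step n r)) D-t))) ⟩
        ((1# - (t * t * Q ^ n) * (t * t * Q ^ n)) * (1# - y)) * (a r * s * d)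
          - (1# + y) * (a r * (s - x) * ((1# - t * t * (Q ^ r * Q ^ n)) * d))
          ≈⟨ solve 7 (λ t v w s x d a →
               ((con 1ℤ :- (t :* t :* w) :* (t :* t :* w)) :* (con 1ℤ :- t :* w)) :* (a :* s :* d)
                 :- (con 1ℤ :+ t :* w) :* (a :* (s :- x) :* ((con 1ℤ :- t :* t :* (v :* w)) :* d))
               := (a :* (x :- (t :* w) :* s) :* ((con 1ℤ :- t :* t :* (v :* w)) :* d)
                    :- (t :* w) :* (con 1ℤ :- t :* v) :* (a :* (s :- x) :* d))
                  :+ a :* d :* t :* t :* w :* (con 1ℤ :- t :* w) :* (v :* x :- (t :* t :* w) :* s))
               refl t (Q ^ r) (Q ^ n) s x d (a r) ⟩
        (a r * (x - y * s) * ((1# - t * t * (Q ^ r * Q ^ n)) * d) - y * (1# - t * Q ^ r) * (a r * (s - x) * d))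
          + a r * d * t * t * Q ^ n * (1# - y) * (Q ^ r * x - (t * t * Q ^ n) * s)
          ≈⟨ +-congˡ (*-[x≈y] _ (trans (Q^r*QDsub (suc n) r) (*-congʳ (Q* _)))) ⟩
        (a r * (x - y * s) * ((1# - t * t * (Q ^ r * Q ^ n)) * d) - y * (1# - t * Q ^ r) * (a r * (s - x) * d)) + 0#
          ≈⟨ +-identityʳ _ ⟩
        a r * (x - y * s) * ((1# - t * t * (Q ^ r * Q ^ n)) * d) - y * (1# - t * Q ^ r) * (a r * (s - x) * d)
          ≈⟨ +-cong (*-congˡ D-t) (-‿cong (*-congˡ (*-congʳ (*-congˡ (Dsub-step n r))))) ⟨
        e r - y * (1# - t * Q ^ r) * (a r * Dsub n r * d)
          ≈⟨ +-congˡ (-‿cong (e-suc r)) ⟨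
        e r - e (suc r) ∎
        where
        s x d : Carrier
        s = Dsub (suc n) r
        x = QDsub (suc n) r
        d = D (suc n ℕ.+ r)
        D-t : D (n ℕ.+ r) ≈ (1# - t * t * (Q ^ r * Q ^ n)) * d
        D-t = trans (D-step+ n r) (*-congʳ (+-congˡ (-‿cong (Q* _))))

-- q-Pochhammer symbols for nilpotent q, and the inner sum of Bailey's argument

module QSeries {c ℓ} (R : CommutativeRing c ℓ) where
  open CommutativeRing R
  open FiniteSums R
  open IntegerSolver R
  open Algebra.Properties.Ring ring
  open Algebra.Properties.Semiring.Exp semiring using (_^_; ^-homo-*; ^-congʳ; ^-assocʳ)
  open Relation.Binary.Reasoning.Setoid setoid

  σ : ℕ → Carrier
  σ n = (- 1#) ^ n

  σ² : ∀ n → σ n * σ n ≈ 1#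
  σ² zero    = *-identityˡ 1#
  σ² (suc n) = trans (solve 1 (λ s → (:- con 1ℤ :* s) :* (:- con 1ℤ :* s) := s :* s) refl (σ n)) (σ² n)

  module Truncated (q : Carrier) (N : ℕ) (q^[1+N]≈0 : q ^ suc N ≈ 0#) where

    q^-vanish : ∀ {n} → N ℕ.< n → q ^ n ≈ 0#
    q^-vanish N<n with k , ≡.refl ← ℕ.m≤n⇒∃[o]m+o≡n N<n =
      trans (^-homo-* q (suc N) k) (trans (*-congʳ q^[1+N]≈0) (zeroˡ _))

    factor factor⁻¹ : ℕ → Carrier
    factor   k = 1# - q ^ k
    factor⁻¹ k = Σ< (suc N) (λ j → q ^ (k ℕ.* j))

    -- The geometric series cut off at j = N is exact, since its remainder q^((k+1)(N+1)) is zero.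
    factor-inverse : ∀ k → factor (suc k) * factor⁻¹ (suc k) ≈ 1#
    factor-inverse k = begin
      factor (suc k) * factor⁻¹ (suc k)
        ≈⟨ Σ-*ˡ (suc N) _ _ ⟨
      Σ< (suc N) (λ j → factor (suc k) * q ^ (suc k ℕ.* j))
        ≈⟨ Σ-telescope (suc N) e step ⟩
      e 0 - e (suc N)
        ≈⟨ +-cong (^-congʳ q (ℕ.*-zeroʳ (suc k))) (-‿cong (q^-vanish (ℕ.m≤m+n (suc N) (k ℕ.* suc N)))) ⟩
      1# - 0#
        ≈⟨ solve 0 (con 1ℤ :- con 0ℤ := con 1ℤ) refl ⟩
      1# ∎
      where
      e : ℕ → Carrier
      e j = q ^ (suc k ℕ.* j)
      step : ∀ j → factor (suc k) * q ^ (suc k ℕ.* j) ≈ e j - e (suc j)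
      step j = begin
        (1# - q ^ suc k) * e j     ≈⟨ solve 2 (λ u e → (con 1ℤ :- u) :* e := e :- u :* e) refl _ _ ⟩
        e j - q ^ suc k * e j      ≈⟨ +-congˡ (-‿cong (^-homo-* q (suc k) (suc k ℕ.* j))) ⟨
        e j - q ^ (suc k ℕ.+ suc k ℕ.* j)  ≈⟨ +-congˡ (-‿cong (^-congʳ q (ℕ.*-suc (suc k) j))) ⟨
        e j - e (suc j)            ∎

    factor≈1 : ∀ {k} → N ℕ.< k → factor k ≈ 1#
    factor≈1 N<k = trans (+-congˡ (-‿cong (q^-vanish N<k))) (solve 0 (con 1ℤ :- con 0ℤ := con 1ℤ) refl)

    factor⁻¹≈1 : ∀ {k} → N ℕ.< k → factor⁻¹ k ≈ 1#
    factor⁻¹≈1 {suc k} N<k =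
      trans (sym (*-identityˡ _)) (trans (*-congʳ (sym (factor≈1 N<k))) (factor-inverse k))

    pochhammer pochhammer⁻¹ : ℕ → ℕ → ℕ → Carrier
    pochhammer   a d n = Π< n (λ i → factor (a ℕ.+ d ℕ.* i))
    pochhammer⁻¹ a d n = Π< n (λ i → factor⁻¹ (a ℕ.+ d ℕ.* i))

    pochhammer-inverse : ∀ a d n → pochhammer (suc a) d n * pochhammer⁻¹ (suc a) d n ≈ 1#
    pochhammer-inverse a d n = trans (sym (Π-* n _ _)) (Π-1 n (λ i → factor-inverse (a ℕ.+ d ℕ.* i)))

    N<a+d[k+N] : ∀ a d k → N ℕ.< suc a ℕ.+ suc d ℕ.* (k ℕ.+ N)
    N<a+d[k+N] a d k = s≤s (ℕ.≤-trans (ℕ.m≤n+m N k)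
      (ℕ.≤-trans (ℕ.m≤m+n (k ℕ.+ N) _) (ℕ.m≤n+m (suc d ℕ.* (k ℕ.+ N)) a)))

    -- All factors from index N on have exponent above N and equal 1, so N factors stand for the
    -- infinite product.
    pochhammer-stable : ∀ a d k → pochhammer (suc a) (suc d) (k ℕ.+ N) ≈ pochhammer (suc a) (suc d) N
    pochhammer-stable a d k = Π-extend N k (λ j → factor≈1 (N<a+d[k+N] a d j))

    pochhammer⁻¹-stable : ∀ a d k → pochhammer⁻¹ (suc a) (suc d) (k ℕ.+ N) ≈ pochhammer⁻¹ (suc a) (suc d) N
    pochhammer⁻¹-stable a d k = Π-extend N k (λ j → factor⁻¹≈1 (N<a+d[k+N] a d j))

    q^-≡* : ∀ {k} m n → k ≡ m ℕ.+ n → q ^ k ≈ q ^ m * q ^ n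
    q^-≡* m n eq = trans (^-congʳ q eq) (^-homo-* q m n)

    -- The recurrence that `InverseFactorials` asks of `D`, with Q = q^(d+1).
    pochhammer⁻¹-step : ∀ d n → pochhammer⁻¹ (suc d) (suc d) n
                        ≈ (1# - (q ^ suc d) ^ suc n) * pochhammer⁻¹ (suc d) (suc d) (suc n)
    pochhammer⁻¹-step d n = begin
      I                              ≈⟨ *-identityˡ _ ⟨
      1# * I                         ≈⟨ *-congʳ (factor-inverse (d ℕ.+ suc d ℕ.* n)) ⟨
      factor k * factor⁻¹ k * I      ≈⟨ solve 3 (λ a b x → a :* b :* x := a :* (x :* b)) refl _ _ _ ⟩
      factor k * (I * factor⁻¹ k)    ≈⟨ *-congʳ (+-congˡ (-‿cong exponent)) ⟩
      (1# - (q ^ suc d) ^ suc n) * (I * factor⁻¹ k) ∎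
      where
      k : ℕ
      k = suc d ℕ.+ suc d ℕ.* n
      I : Carrier
      I = pochhammer⁻¹ (suc d) (suc d) n
      exponent : q ^ k ≈ (q ^ suc d) ^ suc n
      exponent = sym (trans (^-assocʳ q (suc d) (suc n)) (^-congʳ q (ℕ.*-suc (suc d) n)))

    -- (q;q²)_n and 1/(q²;q²)_n
    O D : ℕ → Carrier
    O n = pochhammer 1 2 n
    D n = pochhammer⁻¹ 2 2 n

    D≈[1-Q]D : ∀ n → D n ≈ factor (2 ℕ.+ 2 ℕ.* n) * D (suc n)
    D≈[1-Q]D n = trans (pochhammer⁻¹-step 1 n) (*-congʳ (+-congˡ (-‿cong
      (trans (^-assocʳ q 2 (suc n)) (^-congʳ q (ℕ.*-suc 2 n))))))

    -- B r below is (-1)^r q^{-r²} Σ_{n ≥ r} (q;q²)_n (-1)^n q^{n²} / ((q²;q²)_{n-r} (q²;q²)_{n+r}), summed over m = n - r;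
    -- it does not depend on r, and as r → ∞ only m = 0 survives, so it is (q;q²)_∞ / (q²;q²)_∞.
    module _ (r : ℕ) where

      -- The splitting (m + r)² = r² + (m² + 2rm) takes (-1)^r q^(r²) out of the summand at n = m +
      -- r without a division; `κ` is what remains of its sign and power of q.
      κ b : ℕ → Carrier
      κ m = σ m * q ^ (m ℕ.* m ℕ.+ 2 ℕ.* (r ℕ.* m))
      b m = O (m ℕ.+ r) * κ m * D m * D (m ℕ.+ 2 ℕ.* r)

      κ-suc : ∀ m → κ (suc m) ≈ - (κ m * (q ^ (1 ℕ.+ 2 ℕ.* r) * q ^ (2 ℕ.* m)))
      κ-suc m = trans (*-congˡ (trans (q^-≡* (m ℕ.* m ℕ.+ 2 ℕ.* (r ℕ.* m)) _ (exponent m r))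
                                      (*-congˡ (^-homo-* q (1 ℕ.+ 2 ℕ.* r) (2 ℕ.* m)))))
        (solve 4 (λ s k u v → (:- con 1ℤ :* s) :* (k :* (u :* v)) := :- ((s :* k) :* (u :* v))) refl _ _ _ _)
        where
        exponent : ∀ m r → suc m ℕ.* suc m ℕ.+ 2 ℕ.* (r ℕ.* suc m)
                         ≡ m ℕ.* m ℕ.+ 2 ℕ.* (r ℕ.* m) ℕ.+ (1 ℕ.+ 2 ℕ.* r ℕ.+ 2 ℕ.* m)
        exponent = solve-∀

      q^-double : ∀ m → q ^ (2 ℕ.+ 2 ℕ.* (m ℕ.+ 2 ℕ.* r))
                  ≈ q ^ (1 ℕ.+ 2 ℕ.* r) * (q ^ (1 ℕ.+ 2 ℕ.* r) * q ^ (2 ℕ.* m))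
      q^-double m = trans (q^-≡* (1 ℕ.+ 2 ℕ.* r) _ (exponent m r)) (*-congˡ (^-homo-* q (1 ℕ.+ 2 ℕ.* r) (2 ℕ.* m)))
        where
        exponent : ∀ m r → 2 ℕ.+ 2 ℕ.* (m ℕ.+ 2 ℕ.* r) ≡ 1 ℕ.+ 2 ℕ.* r ℕ.+ (1 ℕ.+ 2 ℕ.* r ℕ.+ 2 ℕ.* m)
        exponent = solve-∀

      q^-next : ∀ m → q ^ (2 ℕ.+ 2 ℕ.* m) ≈ q * q * q ^ (2 ℕ.* m)
      q^-next m = sym (*-assoc _ _ _)

      O-suc : ∀ m → O (suc m ℕ.+ r) ≈ O (m ℕ.+ r) * (1# - q ^ (1 ℕ.+ 2 ℕ.* r) * q ^ (2 ℕ.* m))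
      O-suc m = *-congˡ (+-congˡ (-‿cong (q^-≡* (1 ℕ.+ 2 ℕ.* r) (2 ℕ.* m) (exponent m r))))
        where
        exponent : ∀ m r → 1 ℕ.+ 2 ℕ.* (m ℕ.+ r) ≡ 1 ℕ.+ 2 ℕ.* r ℕ.+ 2 ℕ.* m
        exponent = solve-∀

      D₁ : ∀ m → D (m ℕ.+ 2 ℕ.* r) ≈ (1# - q ^ (1 ℕ.+ 2 ℕ.* r) * (q ^ (1 ℕ.+ 2 ℕ.* r) * q ^ (2 ℕ.* m)))
                                     * D (suc m ℕ.+ 2 ℕ.* r)
      D₁ m = trans (D≈[1-Q]D (m ℕ.+ 2 ℕ.* r)) (*-congʳ (+-congˡ (-‿cong (q^-double m))))

      -- A WZ certificate: b r m - b (r+1) m = e r m - e r (m+1).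
      e : ℕ → Carrier
      e m = O (m ℕ.+ r) * κ m * (1# - s * (1# + s) * u) * ((1# - u) * D m) * D (suc m ℕ.+ 2 ℕ.* r)
        where
        s u : Carrier
        s = q ^ (1 ℕ.+ 2 ℕ.* r)
        u = q ^ (2 ℕ.* m)

    κ-suc-r : ∀ r m → κ (suc r) m ≈ κ r m * q ^ (2 ℕ.* m)
    κ-suc-r r m = trans (*-congˡ (q^-≡* (m ℕ.* m ℕ.+ 2 ℕ.* (r ℕ.* m)) (2 ℕ.* m) (exponent m r))) (sym (*-assoc _ _ _))
      where
      exponent : ∀ m r → m ℕ.* m ℕ.+ 2 ℕ.* (suc r ℕ.* m) ≡ m ℕ.* m ℕ.+ 2 ℕ.* (r ℕ.* m) ℕ.+ 2 ℕ.* m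
      exponent = solve-∀

    b-certificate : ∀ r m → b r m + - 1# * b (suc r) m ≈ e r m - e r (suc m)
    b-certificate r m = begin
      o * k * d * D (m ℕ.+ 2 ℕ.* r)
        + - 1# * (O (m ℕ.+ suc r) * κ (suc r) m * d * D (m ℕ.+ 2 ℕ.* suc r))
        ≈⟨ +-cong (*-congˡ (trans (D₁ r m) (*-congˡ D₂)))
             (*-congˡ (*-cong (*-congʳ (*-cong O₁ (κ-suc-r r m))) (reflexive (≡.cong D (index m r))))) ⟩
      o * k * d * ((1# - s * (s * u)) * ((1# - s * (s * (q * q * u))) * dd))
        + - 1# * (o * (1# - s * u) * (k * u) * d * dd)
        -- Apart from the common factor o k d dd this is an identity between polynomials in u. With
        -- an undetermined factor A + B u in the certificate, the coefficients of u^0 and u^1 force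
        -- A = 1 and B = - s (1 + s); the higher ones then agree.
        ≈⟨ solve 7 (λ o k d dd s u q →
             o :* k :* d :* ((con 1ℤ :- s :* (s :* u)) :* ((con 1ℤ :- s :* (s :* (q :* q :* u))) :* dd))
               :+ :- con 1ℤ :* (o :* (con 1ℤ :- s :* u) :* (k :* u) :* d :* dd)
             := o :* k :* (con 1ℤ :- s :* (con 1ℤ :+ s) :* u) :* ((con 1ℤ :- u) :* d)
                  :* ((con 1ℤ :- s :* (s :* (q :* q :* u))) :* dd)
               :- o :* (con 1ℤ :- s :* u) :* (:- (k :* (s :* u)))
                  :* (con 1ℤ :- s :* (con 1ℤ :+ s) :* (q :* q :* u)) :* d :* dd)
             refl o k d dd s u q ⟩
      o * k * (1# - s * (1# + s) * u) * ((1# - u) * d) * ((1# - s * (s * (q * q * u))) * dd)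
        - o * (1# - s * u) * (- (k * (s * u))) * (1# - s * (1# + s) * (q * q * u)) * d * dd
        ≈⟨ +-cong (*-congˡ D₂) (-‿cong (*-congʳ (*-cong
             (*-cong (*-cong (O-suc r m) (κ-suc r m)) (+-congˡ (-‿cong (*-congˡ next))))
             (trans (*-congʳ (+-congˡ (-‿cong (^-congʳ q (ℕ.*-suc 2 m))))) (sym (D≈[1-Q]D m)))))) ⟨
      e r m - e r (suc m) ∎
      where
      o k d dd s u : Carrier
      o = O (m ℕ.+ r)
      k = κ r m
      d = D m
      dd = D (suc (suc m) ℕ.+ 2 ℕ.* r)
      s = q ^ (1 ℕ.+ 2 ℕ.* r)
      u = q ^ (2 ℕ.* m)
      next : q ^ (2 ℕ.* suc m) ≈ q * q * u
      next = trans (^-congʳ q (ℕ.*-suc 2 m)) (q^-next r m)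
      D₂ : D (suc m ℕ.+ 2 ℕ.* r) ≈ (1# - s * (s * (q * q * u))) * dd
      D₂ = trans (D₁ r (suc m)) (*-congʳ (+-congˡ (-‿cong (*-congˡ (*-congˡ next)))))
      O₁ : O (m ℕ.+ suc r) ≈ o * (1# - s * u)
      O₁ = trans (reflexive (≡.cong O (ℕ.+-suc m r))) (O-suc r m)
      index : ∀ m r → m ℕ.+ 2 ℕ.* suc r ≡ suc (suc m) ℕ.+ 2 ℕ.* r
      index = solve-∀

    B : ℕ → Carrier
    B r = Σ< (suc N) (b r)

    κ-vanish : ∀ r {m} → N ℕ.< m → κ r m ≈ 0#
    κ-vanish r {m@(suc _)} N<m = trans (*-congˡ (q^-vanish (ℕ.≤-trans N<m
      (ℕ.≤-trans (ℕ.m≤m*n m m) (ℕ.m≤m+n (m ℕ.* m) _))))) (zeroʳ _)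

    B-suc : ∀ r → B r ≈ B (suc r)
    B-suc r = begin
      B r
        ≈⟨ solve 2 (λ x y → x := (x :+ :- con 1ℤ :* y) :+ y) refl _ _ ⟩
      (B r + - 1# * B (suc r)) + B (suc r)
        ≈⟨ +-congʳ (trans (+-congˡ (sym (Σ-*ˡ (suc N) (- 1#) _))) (sym (Σ-+ (suc N) _ _))) ⟩
      Σ< (suc N) (λ m → b r m + - 1# * b (suc r) m) + B (suc r)
        ≈⟨ +-congʳ (Σ-telescope (suc N) (e r) (b-certificate r)) ⟩
      (e r 0 - e r (suc N)) + B (suc r)
        -- At m = 0 the certificate vanishes through its factor 1 - q^(2m), and at m = N + 1 through
        -- `κ`, whose exponent is at least (N + 1)².
        ≈⟨ +-congʳ (+-cong (trans (*-congʳ (trans (*-congˡ (trans (*-congʳ (-‿inverseʳ 1#)) (zeroˡ _))) (zeroʳ _))) (zeroˡ _))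
             (-‿cong (trans (*-congʳ (*-congʳ (*-congʳ (*-congˡ (κ-vanish r ℕ.≤-refl)))))
               (solve 4 (λ o a b c → o :* con 0ℤ :* a :* b :* c := con 0ℤ) refl _ _ _ _)))) ⟩
      (0# - 0#) + B (suc r)
        ≈⟨ solve 1 (λ x → (con 0ℤ :- con 0ℤ) :+ x := x) refl _ ⟩
      B (suc r) ∎

    B-const : ∀ r → B 0 ≈ B r
    B-const zero    = refl
    B-const (suc r) = trans (B-const r) (B-suc r)

    O∞ D∞ : Carrier
    O∞ = O N
    D∞ = D N

    B≈O∞D∞ : ∀ r → B r ≈ O∞ * D∞
    B≈O∞D∞ r = begin
      B r
        -- r = N already serves as the limit r → ∞, since m² + 2Nm > N for every m ≥ 1.
        ≈⟨ trans (sym (B-const r)) (B-const N) ⟩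
      B N
        ≈⟨ Σ-front N (b N) ⟩
      b N 0 + Σ< N (λ m → b N (suc m))
        ≈⟨ +-cong (*-cong (*-congʳ (*-congˡ (*-congˡ (^-congʳ q (≡.cong (2 ℕ.*_) (ℕ.*-zeroʳ N))))))
                     (trans (reflexive (≡.cong D (≡.cong (N ℕ.+_) (ℕ.+-identityʳ N)))) (pochhammer⁻¹-stable 1 1 N)))
                  (Σ-0 N tail) ⟩
      O∞ * (1# * 1#) * 1# * D∞ + 0#
        ≈⟨ solve 2 (λ o d → o :* (con 1ℤ :* con 1ℤ) :* con 1ℤ :* d :+ con 0ℤ := o :* d) refl _ _ ⟩
      O∞ * D∞ ∎
      where
      exponent : ∀ N m → suc m ℕ.* suc m ℕ.+ 2 ℕ.* (N ℕ.* suc m) ≡ suc N ℕ.+ (m ℕ.* m ℕ.+ 2 ℕ.* m ℕ.+ N ℕ.+ 2 ℕ.* (N ℕ.* m))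
      exponent = solve-∀
      tail : ∀ m → b N (suc m) ≈ 0#
      tail m = trans (*-congʳ (*-congʳ (*-congˡ (*-congˡ (q^-vanish
          (≡.subst (N ℕ.<_) (≡.sym (exponent N m)) (ℕ.m≤m+n (suc N) _)))))))
        (solve 4 (λ o s d d' → o :* (s :* con 0ℤ) :* d :* d' := con 0ℤ) refl _ _ _ _)

-- The middle series as an infinite product

module Slater {c ℓ} (R : CommutativeRing c ℓ) where
  open CommutativeRing R
  open FiniteSums R
  open IntegerSolver R
  open SymmetricSums R using (module InverseFactorials)
  open QSeries R
  open Algebra.Properties.Ring ring
  open Algebra.Properties.Semiring.Exp semiring using (_^_; ^-homo-*; ^-congʳ; ^-assocʳ)
  open Relation.Binary.Reasoning.Setoid setoid

  [1+r]² : ∀ r → suc r ℕ.* suc r ≡ 1 ℕ.+ (r ℕ.+ r) ℕ.+ r ℕ.* r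
  [1+r]² = solve-∀

  ^-square-suc : ∀ x r → x ^ (suc r ℕ.* suc r) ≈ x * (x ^ r * x ^ r) * x ^ (r ℕ.* r)
  ^-square-suc x r = trans (^-congʳ x ([1+r]² r)) (trans (^-homo-* x (1 ℕ.+ (r ℕ.+ r)) (r ℕ.* r))
    (*-congʳ (*-congˡ (^-homo-* x r r))))

  σ-+ : ∀ m n → σ (m ℕ.+ n) ≈ σ m * σ n
  σ-+ = ^-homo-* (- 1#)

  Π-bisect : ∀ (h : ℕ → Carrier) a d n → Π< (n ℕ.* 2) (λ i → h (a ℕ.+ d ℕ.* i))
    ≈ Π< n (λ i → h (a ℕ.+ 2 ℕ.* d ℕ.* i)) * Π< n (λ i → h (a ℕ.+ d ℕ.+ 2 ℕ.* d ℕ.* i))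
  Π-bisect h a d zero    = sym (*-identityˡ 1#)
  Π-bisect h a d (suc n) = trans
    (*-cong (*-cong (Π-bisect h a d n) (reflexive (≡.cong h (index₀ a d n)))) (reflexive (≡.cong h (index₁ a d n))))
    (solve 4 (λ p r x y → ((p :* r) :* x) :* y := (p :* x) :* (r :* y)) refl _ _ _ _)
    where
    index₀ : ∀ a d n → a ℕ.+ d ℕ.* (n ℕ.* 2) ≡ a ℕ.+ 2 ℕ.* d ℕ.* n
    index₀ = solve-∀
    index₁ : ∀ a d n → a ℕ.+ d ℕ.* suc (n ℕ.* 2) ≡ a ℕ.+ d ℕ.+ 2 ℕ.* d ℕ.* n
    index₁ = solve-∀

  Π-trisect : ∀ (h : ℕ → Carrier) a d n → Π< (n ℕ.* 3) (λ i → h (a ℕ.+ d ℕ.* i))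
    ≈ Π< n (λ i → h (a ℕ.+ 3 ℕ.* d ℕ.* i)) * Π< n (λ i → h (a ℕ.+ d ℕ.+ 3 ℕ.* d ℕ.* i))
      * Π< n (λ i → h (a ℕ.+ 2 ℕ.* d ℕ.+ 3 ℕ.* d ℕ.* i))
  Π-trisect h a d zero    = solve 0 (con 1ℤ := con 1ℤ :* con 1ℤ :* con 1ℤ) refl
  Π-trisect h a d (suc n) = trans
    (*-cong (*-cong (*-cong (Π-trisect h a d n) (reflexive (≡.cong h (index₀ a d n))))
      (reflexive (≡.cong h (index₁ a d n)))) (reflexive (≡.cong h (index₂ a d n))))
    (solve 6 (λ p r s x y z → (((p :* r :* s) :* x) :* y) :* z := (p :* x) :* (r :* y) :* (s :* z)) refl _ _ _ _ _ _)
    where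
    index₀ : ∀ a d n → a ℕ.+ d ℕ.* (n ℕ.* 3) ≡ a ℕ.+ 3 ℕ.* d ℕ.* n
    index₀ = solve-∀
    index₁ : ∀ a d n → a ℕ.+ d ℕ.* suc (n ℕ.* 3) ≡ a ℕ.+ d ℕ.+ 3 ℕ.* d ℕ.* n
    index₁ = solve-∀
    index₂ : ∀ a d n → a ℕ.+ d ℕ.* suc (suc (n ℕ.* 3)) ≡ a ℕ.+ 2 ℕ.* d ℕ.+ 3 ℕ.* d ℕ.* n
    index₂ = solve-∀

  module Identity (q : Carrier) (N : ℕ) (q^[1+N]≈0 : q ^ suc N ≈ 0#) where

    open Truncated q N q^[1+N]≈0

    module Q² = InverseFactorials (q ^ 2) (pochhammer⁻¹ 2 2) refl (pochhammer⁻¹-step 1)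
    module Q⁶ = InverseFactorials (q ^ 6) (pochhammer⁻¹ 6 6) refl (pochhammer⁻¹-step 5)

    ^-square-vanish : ∀ d {m} → N ℕ.< m → (q ^ suc d) ^ (m ℕ.* m) ≈ 0#
    ^-square-vanish d {m@(suc _)} N<m = trans (^-assocʳ q (suc d) (m ℕ.* m))
      (q^-vanish (ℕ.≤-trans N<m (ℕ.≤-trans (ℕ.m≤m*n m m) (ℕ.m≤m+n (m ℕ.* m) _))))

    gaussCoeff jacobiCoeff : ℕ → Carrier
    gaussCoeff  r = σ r * (q ^ 2) ^ (r ℕ.* r)
    jacobiCoeff r = (q ^ 3) ^ (r ℕ.* r)

    J : ℕ → Carrier
    J = pochhammer⁻¹ 4 4

    -- Σ_{|r| ≤ n} (-1)^r Q^{r²} / ((Q;Q)_{n-r} (Q;Q)_{n+r}) = 1 / (Q²;Q²)_n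
    Θ-gauss≈J : ∀ n → Q².Θ gaussCoeff N n ≈ J n
    Θ-gauss≈J zero    = Q².Θ0 gaussCoeff N (*-identityˡ 1#)
    Θ-gauss≈J (suc n) = begin
      Θ' (suc n)                                    ≈⟨ *-identityʳ _ ⟨
      Θ' (suc n) * 1#                               ≈⟨ *-congˡ (factor-inverse (3 ℕ.+ 4 ℕ.* n)) ⟨
      Θ' (suc n) * (factor k * factor⁻¹ k)          ≈⟨ solve 3 (λ a b x → x :* (a :* b) := (a :* x) :* b) refl _ _ _ ⟩
      (factor k * Θ' (suc n)) * factor⁻¹ k          ≈⟨ *-congʳ (*-congʳ (+-congˡ (-‿cong exponent))) ⟩
      ((1# - (q ^ 2) ^ suc n * (q ^ 2) ^ suc n) * Θ' (suc n)) * factor⁻¹ k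
        ≈⟨ *-congʳ (Q².Θ-gauss gaussCoeff N step (*-identityˡ 1#)
             (trans (*-congˡ (^-square-vanish 1 ℕ.≤-refl)) (zeroʳ _)) n) ⟩
      Θ' n * factor⁻¹ k                             ≈⟨ *-congʳ (Θ-gauss≈J n) ⟩
      J n * factor⁻¹ k                              ∎
      where
      k : ℕ
      k = 4 ℕ.+ 4 ℕ.* n
      Θ' : ℕ → Carrier
      Θ' = Q².Θ gaussCoeff N
      index : ∀ n → 4 ℕ.+ 4 ℕ.* n ≡ 2 ℕ.* suc n ℕ.+ 2 ℕ.* suc n
      index = solve-∀
      exponent : q ^ k ≈ (q ^ 2) ^ suc n * (q ^ 2) ^ suc n
      exponent = trans (q^-≡* (2 ℕ.* suc n) (2 ℕ.* suc n) (index n))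
        (sym (*-cong (^-assocʳ q 2 (suc n)) (^-assocʳ q 2 (suc n))))
      step : ∀ r → gaussCoeff (suc r) ≈ - (q ^ 2 * ((q ^ 2) ^ r * (q ^ 2) ^ r)) * gaussCoeff r
      step r = trans (*-congˡ (^-square-suc (q ^ 2) r))
        (solve 3 (λ s u v → (:- con 1ℤ :* s) :* (u :* v) := (:- u) :* (s :* v)) refl _ _ _)

    g summand : ℕ → Carrier
    g n = O n * (σ n * q ^ (n ℕ.* n))
    summand n = g n * J n

    g-vanish : ∀ {n} → N ℕ.< n → g n ≈ 0#
    g-vanish {n@(suc _)} N<n = trans (*-congˡ (trans (*-congˡ (q^-vanish
      (ℕ.≤-trans N<n (ℕ.m≤m*n n n)))) (zeroʳ _))) (zeroʳ _)

    inner-sum : ∀ r → Σ< (suc N) (λ n → g n * (Q².Dsub n r * D (n ℕ.+ r))) ≈ σ r * q ^ (r ℕ.* r) * (O∞ * D∞)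
    inner-sum r = begin
      Σ< (suc N) f
        -- Adding r zero terms at the top compensates for the r zero terms n < r at the bottom, so
        -- that m = n - r runs over 0, ..., N whatever r is, as in `B r`.
        ≈⟨ Σ-extend (suc N) r (λ k → trans (*-congʳ (g-vanish (ℕ.m≤n+m (suc N) k))) (zeroˡ _)) ⟨
      Σ< (r ℕ.+ suc N) f
        ≈⟨ reflexive (≡.cong (λ n → Σ< n f) (ℕ.+-comm r (suc N))) ⟩
      Σ< (suc N ℕ.+ r) f
        ≈⟨ Σ-split r (suc N) f ⟩
      Σ< r f + Σ< (suc N) (λ m → f (m ℕ.+ r))
        ≈⟨ +-cong (Σ-0< r below)
                  (trans (Σ-cong (suc N) shifted) (Σ-*ˡ (suc N) _ _)) ⟩
      0# + σ r * q ^ (r ℕ.* r) * B r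
        ≈⟨ +-identityˡ _ ⟩
      σ r * q ^ (r ℕ.* r) * B r
        ≈⟨ *-congˡ (B≈O∞D∞ r) ⟩
      σ r * q ^ (r ℕ.* r) * (O∞ * D∞) ∎
      where
      f : ℕ → Carrier
      f n = g n * (Q².Dsub n r * D (n ℕ.+ r))
      square : ∀ m r → (m ℕ.+ r) ℕ.* (m ℕ.+ r) ≡ r ℕ.* r ℕ.+ (m ℕ.* m ℕ.+ 2 ℕ.* (r ℕ.* m))
      square = solve-∀
      index : ∀ m r → m ℕ.+ r ℕ.+ r ≡ m ℕ.+ 2 ℕ.* r
      index = solve-∀
      below : ∀ {k} → k ℕ.< r → f k ≈ 0#
      below {k} k<r = begin
        g k * (Q².Dsub k r * D (k ℕ.+ r))  ≈⟨ *-congˡ (*-congʳ (reflexive (Q².Dsub-< k<r))) ⟩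
        g k * (0# * D (k ℕ.+ r))           ≈⟨ solve 2 (λ x y → x :* (con 0ℤ :* y) := con 0ℤ) refl (g k) (D (k ℕ.+ r)) ⟩
        0#                                 ∎
      shifted : ∀ m → f (m ℕ.+ r) ≈ σ r * q ^ (r ℕ.* r) * b r m
      shifted m = begin
        O (m ℕ.+ r) * (σ (m ℕ.+ r) * q ^ ((m ℕ.+ r) ℕ.* (m ℕ.+ r))) * (Q².Dsub (m ℕ.+ r) r * D (m ℕ.+ r ℕ.+ r))
          ≈⟨ *-cong (*-congˡ (*-cong (σ-+ m r) (q^-≡* (r ℕ.* r) (m ℕ.* m ℕ.+ 2 ℕ.* (r ℕ.* m)) (square m r))))
                    (*-cong (reflexive (Q².Dsub-+ m r)) (reflexive (≡.cong D (index m r)))) ⟩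
        O (m ℕ.+ r) * ((σ m * σ r) * (q ^ (r ℕ.* r) * q ^ (m ℕ.* m ℕ.+ 2 ℕ.* (r ℕ.* m)))) * (D m * D (m ℕ.+ 2 ℕ.* r))
          ≈⟨ solve 7 (λ o sm sr qr qm d d' → (o :* ((sm :* sr) :* (qr :* qm))) :* (d :* d')
                  := sr :* qr :* (o :* (sm :* qm) :* d :* d')) refl
                  (O (m ℕ.+ r)) (σ m) (σ r) (q ^ (r ℕ.* r)) (q ^ (m ℕ.* m ℕ.+ 2 ℕ.* (r ℕ.* m))) (D m) (D (m ℕ.+ 2 ℕ.* r)) ⟩
        σ r * q ^ (r ℕ.* r) * b r m ∎

    -- The theta series Σ q^(3r²) over all integers r, folded at r = 0; terms with |r| > N vanish.
    φ : Carrier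
    φ = jacobiCoeff 0 + (1# + 1#) * Σ< N (jacobiCoeff ∘ suc)

    -- The signs of (-1)^r q^(2r²) and (-1)^r q^(r²) cancel and the exponents add up to 3r²; this is
    -- where the cube in the modulus 6 comes from.
    gauss*inner : ∀ r → gaussCoeff r * Σ< (suc N) (λ n → g n * (Q².Dsub n r * D (n ℕ.+ r))) ≈ (O∞ * D∞) * jacobiCoeff r
    gauss*inner r = begin
      gaussCoeff r * Σ< (suc N) (λ n → g n * (Q².Dsub n r * D (n ℕ.+ r)))
        ≈⟨ *-congˡ (inner-sum r) ⟩
      (σ r * (q ^ 2) ^ (r ℕ.* r)) * (σ r * q ^ (r ℕ.* r) * (O∞ * D∞))
        ≈⟨ solve 4 (λ s u v x → (s :* u) :* (s :* v :* x) := (s :* s) :* (x :* (v :* u))) refl _ _ _ _ ⟩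
      (σ r * σ r) * ((O∞ * D∞) * (q ^ (r ℕ.* r) * (q ^ 2) ^ (r ℕ.* r)))
        ≈⟨ *-cong (σ² r) (*-congˡ (trans (*-congˡ (^-assocʳ q 2 (r ℕ.* r)))
             (trans (sym (^-homo-* q (r ℕ.* r) (2 ℕ.* (r ℕ.* r)))) (sym (^-assocʳ q 3 (r ℕ.* r)))))) ⟩
      1# * ((O∞ * D∞) * jacobiCoeff r)
        ≈⟨ *-identityˡ _ ⟩
      (O∞ * D∞) * jacobiCoeff r ∎

    Σ-summand≈O∞D∞φ : Σ< (suc N) summand ≈ (O∞ * D∞) * φ
    Σ-summand≈O∞D∞φ = begin
      Σ< (suc N) summand
        ≈⟨ Σ-cong (suc N) (λ n → trans (*-congˡ (sym (Θ-gauss≈J n))) (expand n)) ⟩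
      Σ< (suc N) (λ n → a 0 * F n 0 + (1# + 1#) * Σ< N (λ r → a (suc r) * F n (suc r)))
        ≈⟨ Σ-+ (suc N) _ _ ⟩
      Σ< (suc N) (λ n → a 0 * F n 0) + Σ< (suc N) (λ n → (1# + 1#) * Σ< N (λ r → a (suc r) * F n (suc r)))
        ≈⟨ +-cong (Σ-*ˡ (suc N) (a 0) _) (trans (Σ-*ˡ (suc N) (1# + 1#) _) (*-congˡ (Σ-swap (suc N) N _))) ⟩
      a 0 * Σ< (suc N) (λ n → F n 0) + (1# + 1#) * Σ< N (λ r → Σ< (suc N) (λ n → a (suc r) * F n (suc r)))
        ≈⟨ +-cong (gauss*inner 0) (*-congˡ (trans
             (Σ-cong N (λ r → trans (Σ-*ˡ (suc N) (a (suc r)) _) (gauss*inner (suc r)))) (Σ-*ˡ N _ _))) ⟩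
      (O∞ * D∞) * jacobiCoeff 0 + (1# + 1#) * ((O∞ * D∞) * Σ< N (jacobiCoeff ∘ suc))
        ≈⟨ solve 3 (λ x y z → x :* y :+ (con 1ℤ :+ con 1ℤ) :* (x :* z) := x :* (y :+ (con 1ℤ :+ con 1ℤ) :* z)) refl _ _ _ ⟩
      (O∞ * D∞) * φ ∎
      where
      a : ℕ → Carrier
      a = gaussCoeff
      F : ℕ → ℕ → Carrier
      F n r = g n * (Q².Dsub n r * D (n ℕ.+ r))
      expand : ∀ n → g n * Q².Θ a N n ≈ a 0 * F n 0 + (1# + 1#) * Σ< N (λ r → a (suc r) * F n (suc r))
      expand n = begin
        g n * (a 0 * Q².Dsub n 0 * D (n ℕ.+ 0) + (1# + 1#) * Σ< N (λ r → a (suc r) * Q².Dsub n (suc r) * D (n ℕ.+ suc r)))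
          ≈⟨ solve 5 (λ g a d d' s → g :* (a :* d :* d' :+ (con 1ℤ :+ con 1ℤ) :* s)
               := a :* (g :* (d :* d')) :+ (con 1ℤ :+ con 1ℤ) :* (g :* s)) refl _ _ _ _ _ ⟩
        a 0 * F n 0 + (1# + 1#) * (g n * Σ< N (λ r → a (suc r) * Q².Dsub n (suc r) * D (n ℕ.+ suc r)))
          ≈⟨ +-congˡ (*-congˡ (trans (sym (Σ-*ˡ N (g n) _)) (Σ-cong N (λ r →
               solve 4 (λ g a d d' → g :* (a :* d :* d') := a :* (g :* (d :* d'))) refl _ _ _ _)))) ⟩
        a 0 * F n 0 + (1# + 1#) * Σ< N (λ r → a (suc r) * F n (suc r)) ∎

    P₃ P₁₂ R₆ I₆ : ℕ → Carrier
    P₃  = pochhammer 3 6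
    P₁₂ = pochhammer 12 12
    R₆  = pochhammer 6 12
    I₆  = pochhammer⁻¹ 6 6

    -- With t = q³ the finite triple product evaluates Θ to (-t;t²)_n / ((t⁴;t⁴)_n (t;t²)_n). The
    -- second factor `P₃` turns (-t;t²)_n into (t²;t⁴)_n, so no product with plus signs remains.
    Θ-jacobi-product : ∀ n → Q⁶.Θ jacobiCoeff N n * (P₁₂ n * (P₃ n * P₃ n)) ≈ R₆ n
    Θ-jacobi-product zero = trans (*-cong (Q⁶.Θ0 jacobiCoeff N refl) (trans (*-identityˡ _) (*-identityˡ _))) (*-identityˡ 1#)
    Θ-jacobi-product (suc n) = begin
      Θ' (suc n) * ((P₁₂ n * factor (12 ℕ.+ 12 ℕ.* n)) * ((P₃ n * factor (3 ℕ.+ 6 ℕ.* n)) * (P₃ n * factor (3 ℕ.+ 6 ℕ.* n))))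
        ≈⟨ *-congˡ (*-cong (*-congˡ (+-congˡ (-‿cong q^12)))
             (*-cong (*-congˡ (+-congˡ (-‿cong q^3))) (*-congˡ (+-congˡ (-‿cong q^3))))) ⟩
      Θ' (suc n) * ((P₁₂ n * (1# - u * u)) * ((P₃ n * (1# - y)) * (P₃ n * (1# - y))))
        ≈⟨ solve 5 (λ θ p u r y → θ :* ((p :* (con 1ℤ :- u :* u)) :* ((r :* (con 1ℤ :- y)) :* (r :* (con 1ℤ :- y))))
             := ((con 1ℤ :- u :* u) :* (con 1ℤ :- y)) :* θ :* (p :* (r :* r) :* (con 1ℤ :- y))) refl _ _ _ _ _ ⟩
      ((1# - u * u) * (1# - y)) * Θ' (suc n) * (P₁₂ n * (P₃ n * P₃ n) * (1# - y))
        ≈⟨ *-congʳ (Q⁶.Θ-jacobi jacobiCoeff N (q ^ 3) (sym (^-homo-* q 3 3)) step refl (^-square-vanish 2 ℕ.≤-refl) n) ⟩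
      (1# + y) * Θ' n * (P₁₂ n * (P₃ n * P₃ n) * (1# - y))
        ≈⟨ solve 3 (λ θ p y → (con 1ℤ :+ y) :* θ :* (p :* (con 1ℤ :- y)) := (θ :* p) :* (con 1ℤ :- y :* y)) refl _ _ _ ⟩
      Θ' n * (P₁₂ n * (P₃ n * P₃ n)) * (1# - y * y)
        ≈⟨ *-cong (Θ-jacobi-product n) (+-congˡ (-‿cong q^6)) ⟩
      R₆ n * factor (6 ℕ.+ 12 ℕ.* n) ∎
      where
      Θ' : ℕ → Carrier
      Θ' = Q⁶.Θ jacobiCoeff N
      u y : Carrier
      u = (q ^ 6) ^ suc n
      y = q ^ 3 * (q ^ 6) ^ n
      index₁₂ : ∀ n → 12 ℕ.+ 12 ℕ.* n ≡ 6 ℕ.* suc n ℕ.+ 6 ℕ.* suc n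
      index₁₂ = solve-∀
      index₆ : ∀ n → 6 ℕ.+ 12 ℕ.* n ≡ 3 ℕ.+ 6 ℕ.* n ℕ.+ (3 ℕ.+ 6 ℕ.* n)
      index₆ = solve-∀
      q^12 : q ^ (12 ℕ.+ 12 ℕ.* n) ≈ u * u
      q^12 = trans (q^-≡* (6 ℕ.* suc n) (6 ℕ.* suc n) (index₁₂ n))
        (sym (*-cong (^-assocʳ q 6 (suc n)) (^-assocʳ q 6 (suc n))))
      q^3 : q ^ (3 ℕ.+ 6 ℕ.* n) ≈ y
      q^3 = trans (^-homo-* q 3 (6 ℕ.* n)) (*-congˡ (sym (^-assocʳ q 6 n)))
      q^6 : y * y ≈ q ^ (6 ℕ.+ 12 ℕ.* n)
      q^6 = trans (*-cong (sym q^3) (sym q^3)) (sym (q^-≡* (3 ℕ.+ 6 ℕ.* n) (3 ℕ.+ 6 ℕ.* n) (index₆ n)))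
      step : ∀ r → jacobiCoeff (suc r) ≈ q ^ 3 * (q ^ 6) ^ r * jacobiCoeff r
      step r = trans (^-square-suc (q ^ 3) r) (*-congʳ (*-congˡ
        (trans (*-cong (^-assocʳ q 3 r) (^-assocʳ q 3 r))
        (trans (sym (q^-≡* (3 ℕ.* r) (3 ℕ.* r) (double r))) (sym (^-assocʳ q 6 r))))))
        where
        double : ∀ r → 6 ℕ.* r ≡ 3 ℕ.* r ℕ.+ 3 ℕ.* r
        double = solve-∀

    -- At n = 2N both n - r and n + r are at least N for every r ≤ N, so both inverse factorials
    -- have reached their limit; for r > N the coefficient q^(3r²) is zero.
    Θ-jacobi-limit : Q⁶.Θ jacobiCoeff N (N ℕ.+ N) ≈ φ * (I₆ N * I₆ N)
    Θ-jacobi-limit = begin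
      T 0 + (1# + 1#) * Σ< N (T ∘ suc)
        ≈⟨ +-cong (stable 0) (*-congˡ (trans (Σ-cong N (stable ∘ suc)) (Σ-*ˡ N _ _))) ⟩
      I₆ N * I₆ N * jacobiCoeff 0 + (1# + 1#) * (I₆ N * I₆ N * Σ< N (jacobiCoeff ∘ suc))
        ≈⟨ solve 3 (λ x y z → x :* y :+ (con 1ℤ :+ con 1ℤ) :* (x :* z) := (y :+ (con 1ℤ :+ con 1ℤ) :* z) :* x) refl _ _ _ ⟩
      φ * (I₆ N * I₆ N) ∎
      where
      T : ℕ → Carrier
      T r = jacobiCoeff r * Q⁶.Dsub (N ℕ.+ N) r * I₆ (N ℕ.+ N ℕ.+ r)
      index : ∀ m r → m ℕ.+ r ℕ.+ (m ℕ.+ r) ≡ m ℕ.+ (m ℕ.+ r) ℕ.+ r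
      index = solve-∀
      index' : ∀ n r → n ℕ.+ n ℕ.+ r ≡ n ℕ.+ r ℕ.+ n
      index' = solve-∀
      Dsub-stable : ∀ {r} → r ℕ.≤ N → Q⁶.Dsub (N ℕ.+ N) r ≈ I₆ N
      Dsub-stable {r} r≤N = trans (reflexive (≡.trans (≡.cong (λ n → Q⁶.Dsub n r) 2N≡) (Q⁶.Dsub-+ _ r)))
        (pochhammer⁻¹-stable 5 5 (N ℕ.∸ r))
        where
        2N≡ : N ℕ.+ N ≡ N ℕ.∸ r ℕ.+ N ℕ.+ r
        2N≡ = ≡.trans (≡.cong₂ ℕ._+_ (≡.sym (ℕ.m∸n+n≡m r≤N)) (≡.sym (ℕ.m∸n+n≡m r≤N)))
          (≡.trans (index (N ℕ.∸ r) r) (≡.cong (λ n → N ℕ.∸ r ℕ.+ n ℕ.+ r) (ℕ.m∸n+n≡m r≤N)))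
      small : ∀ {r} → r ℕ.≤ N → T r ≈ I₆ N * I₆ N * jacobiCoeff r
      small {r} r≤N = begin
        jacobiCoeff r * Q⁶.Dsub (N ℕ.+ N) r * I₆ (N ℕ.+ N ℕ.+ r)
          ≈⟨ *-cong (*-congˡ (Dsub-stable r≤N))
               (trans (reflexive (≡.cong I₆ (index' N r))) (pochhammer⁻¹-stable 5 5 (N ℕ.+ r))) ⟩
        jacobiCoeff r * I₆ N * I₆ N
          ≈⟨ solve 2 (λ a d → a :* d :* d := d :* d :* a) refl (jacobiCoeff r) (I₆ N) ⟩
        I₆ N * I₆ N * jacobiCoeff r ∎
      large : ∀ {r} → N ℕ.< r → T r ≈ I₆ N * I₆ N * jacobiCoeff r
      large {r} N<r = begin
        jacobiCoeff r * Q⁶.Dsub (N ℕ.+ N) r * I₆ (N ℕ.+ N ℕ.+ r)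
          ≈⟨ *-congʳ (*-congʳ (^-square-vanish 2 N<r)) ⟩
        0# * Q⁶.Dsub (N ℕ.+ N) r * I₆ (N ℕ.+ N ℕ.+ r)
          ≈⟨ solve 3 (λ d d' x → con 0ℤ :* d :* d' := x :* con 0ℤ) refl
               (Q⁶.Dsub (N ℕ.+ N) r) (I₆ (N ℕ.+ N ℕ.+ r)) (I₆ N * I₆ N) ⟩
        I₆ N * I₆ N * 0#
          ≈⟨ *-congˡ (^-square-vanish 2 N<r) ⟨
        I₆ N * I₆ N * jacobiCoeff r ∎
      stable : ∀ r → T r ≈ I₆ N * I₆ N * jacobiCoeff r
      stable r = [ small , large ]′ (ℕ.≤-<-connex r N)

    φ-product : φ * (I₆ N * I₆ N) * (P₁₂ N * (P₃ N * P₃ N)) ≈ R₆ N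
    φ-product = begin
      φ * (I₆ N * I₆ N) * (P₁₂ N * (P₃ N * P₃ N))
        ≈⟨ *-cong Θ-jacobi-limit (*-cong (pochhammer-stable 11 11 N)
             (*-cong (pochhammer-stable 2 5 N) (pochhammer-stable 2 5 N))) ⟨
      Q⁶.Θ jacobiCoeff N (N ℕ.+ N) * (P₁₂ (N ℕ.+ N) * (P₃ (N ℕ.+ N) * P₃ (N ℕ.+ N)))
        ≈⟨ Θ-jacobi-product (N ℕ.+ N) ⟩
      R₆ (N ℕ.+ N)
        ≈⟨ pochhammer-stable 5 11 N ⟩
      R₆ N ∎

    N*2 : N ℕ.* 2 ≡ N ℕ.+ N
    N*2 = twice N
      where
      twice : ∀ n → n ℕ.* 2 ≡ n ℕ.+ n
      twice = solve-∀

    N*3 : N ℕ.* 3 ≡ N ℕ.+ N ℕ.+ N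
    N*3 = thrice N
      where
      thrice : ∀ n → n ℕ.* 3 ≡ n ℕ.+ n ℕ.+ n
      thrice = solve-∀

    -- The odd and the even multiples of 6 together give (q⁶;q⁶) with 2N factors, which is already
    -- stable.
    I₆P₁₂R₆≈1 : I₆ N * (R₆ N * P₁₂ N) ≈ 1#
    I₆P₁₂R₆≈1 = begin
      I₆ N * (R₆ N * P₁₂ N)             ≈⟨ *-congˡ (Π-bisect factor 6 6 N) ⟨
      I₆ N * pochhammer 6 6 (N ℕ.* 2)   ≈⟨ *-congˡ (trans (reflexive (≡.cong (pochhammer 6 6) N*2)) (pochhammer-stable 5 5 N)) ⟩
      I₆ N * pochhammer 6 6 N           ≈⟨ *-comm _ _ ⟩
      pochhammer 6 6 N * I₆ N           ≈⟨ pochhammer-inverse 5 6 N ⟩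
      1#                                ∎

    -- Multiplying by two products equal to 1 completes the left side to that of `φ-product`, with
    -- one `R₆` and the inverse of `P₃` left over.
    P₃I₆φ : P₃ N * I₆ N * φ ≈ R₆ N * (R₆ N * pochhammer⁻¹ 3 6 N)
    P₃I₆φ = begin
      P₃ N * I₆ N * φ
        ≈⟨ solve 1 (λ x → x := x :* con 1ℤ :* con 1ℤ) refl _ ⟩
      P₃ N * I₆ N * φ * 1# * 1#
        ≈⟨ *-cong (*-congˡ I₆P₁₂R₆≈1) (pochhammer-inverse 2 6 N) ⟨
      P₃ N * I₆ N * φ * (I₆ N * (R₆ N * P₁₂ N)) * (P₃ N * I₃)
        ≈⟨ solve 6 (λ p i f r p' i' → p :* i :* f :* (i :* (r :* p')) :* (p :* i')
             := (f :* (i :* i) :* (p' :* (p :* p))) :* (r :* i')) refl _ _ _ _ _ _ ⟩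
      (φ * (I₆ N * I₆ N) * (P₁₂ N * (P₃ N * P₃ N))) * (R₆ N * I₃)
        ≈⟨ *-congʳ φ-product ⟩
      R₆ N * (R₆ N * I₃) ∎
      where
      I₃ : Carrier
      I₃ = pochhammer⁻¹ 3 6 N

    Σ-summand≈product : Σ< (suc N) summand ≈
      pochhammer 1 6 N * (pochhammer 5 6 N * (R₆ N * (R₆ N *
      (pochhammer⁻¹ 2 6 N * (pochhammer⁻¹ 3 6 N * pochhammer⁻¹ 4 6 N)))))
    Σ-summand≈product = begin
      Σ< (suc N) summand
        ≈⟨ Σ-summand≈O∞D∞φ ⟩
      (O N * D N) * φ
        -- Odd exponents are 1, 3, 5 modulo 6 and even ones 2, 4, 6. The classes 3 and 6 are
        -- absorbed by `φ`; the others already belong to the product.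
        ≈⟨ *-congʳ (*-cong O∞-trisect D∞-trisect) ⟩
      ((P₁ * P₃ N * P₅) * (I₂ * I₄ * I₆ N)) * φ
        ≈⟨ solve 7 (λ p₁ p₃ p₅ i₂ i₄ i₆ f → ((p₁ :* p₃ :* p₅) :* (i₂ :* i₄ :* i₆)) :* f
             := (p₁ :* p₅ :* i₂ :* i₄) :* (p₃ :* i₆ :* f)) refl _ _ _ _ _ _ _ ⟩
      (P₁ * P₅ * I₂ * I₄) * (P₃ N * I₆ N * φ)
        ≈⟨ *-congˡ P₃I₆φ ⟩
      (P₁ * P₅ * I₂ * I₄) * (R₆ N * (R₆ N * I₃))
        ≈⟨ solve 6 (λ p₁ p₅ i₂ i₃ i₄ r → (p₁ :* p₅ :* i₂ :* i₄) :* (r :* (r :* i₃))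
             := p₁ :* (p₅ :* (r :* (r :* (i₂ :* (i₃ :* i₄)))))) refl _ _ _ _ _ _ ⟩
      P₁ * (P₅ * (R₆ N * (R₆ N * (I₂ * (I₃ * I₄))))) ∎
      where
      P₁ P₅ I₂ I₃ I₄ : Carrier
      P₁ = pochhammer 1 6 N
      P₅ = pochhammer 5 6 N
      I₂ = pochhammer⁻¹ 2 6 N
      I₃ = pochhammer⁻¹ 3 6 N
      I₄ = pochhammer⁻¹ 4 6 N
      O∞-trisect : O N ≈ P₁ * P₃ N * P₅
      O∞-trisect = trans (sym (trans (reflexive (≡.cong O N*3)) (pochhammer-stable 0 1 (N ℕ.+ N)))) (Π-trisect factor 1 2 N)
      D∞-trisect : D N ≈ I₂ * I₄ * I₆ N
      D∞-trisect = trans (sym (trans (reflexive (≡.cong D N*3)) (pochhammer⁻¹-stable 1 1 (N ℕ.+ N)))) (Π-trisect factor⁻¹ 2 2 N)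

-- Partitions in 𝒫₄ by largest part

isOdd-even : ∀ n → isOdd (n ℕ.* 2) ≡ false
isOdd-even zero    = ≡.refl
isOdd-even (suc n) = isOdd-even n

isOdd-odd : ∀ n → isOdd (suc (n ℕ.* 2)) ≡ true
isOdd-odd zero    = ≡.refl
isOdd-odd (suc n) = isOdd-odd n

-- The gap condition with the parities as separate arguments, so that parities and difference can be
-- rewritten independently.
gapOK : Bool → Bool → ℕ → Bool
gapOK o o' d = if o ∧ o' then d % 4 ≡ᵇ 2
               else if not o ∧ not o' then d % 4 ≡ᵇ 0
               else d % 4 ≡ᵇ 3

<ᵇ-true : ∀ {m n} → m ℕ.< n → (m <ᵇ n) ≡ true
<ᵇ-true m<n = Equivalence.to T-≡ (ℕ.<⇒<ᵇ m<n)

consecutiveOK-gap : ∀ {x y} → y ℕ.< x → consecutiveOK x y ≡ gapOK (isOdd x) (isOdd y) (x ℕ.∸ y)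
consecutiveOK-gap {x} {y} y<x = ≡.cong (_∧ gapOK (isOdd x) (isOdd y) (x ℕ.∸ y)) (<ᵇ-true y<x)

-- Only the parities and the difference modulo 4 matter. This periodicity is the source of the
-- recurrence for `L`.
consecutiveOK-4+ : ∀ {x y} → y ℕ.< x → consecutiveOK (4 ℕ.+ x) y ≡ consecutiveOK x y
consecutiveOK-4+ {x} {y} y<x = ≡.trans (consecutiveOK-gap (ℕ.m≤n⇒m≤o+n 4 y<x))
  (≡.trans (≡.cong (gapOK (isOdd x) (isOdd y)) (ℕ.+-∸-assoc 4 (ℕ.<⇒≤ y<x))) (≡.sym (consecutiveOK-gap y<x)))

consecutiveOK-+ : ∀ d y → consecutiveOK (suc d ℕ.+ y) y ≡ gapOK (isOdd (suc d ℕ.+ y)) (isOdd y) (suc d)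
consecutiveOK-+ d y = ≡.trans (consecutiveOK-gap (s≤s (ℕ.m≤n+m y d)))
  (≡.cong (gapOK (isOdd (suc d ℕ.+ y)) (isOdd y)) (ℕ.m+n∸n≡m (suc d) y))

module Partitions {c ℓ} (R : CommutativeRing c ℓ) where
  open CommutativeRing R
  open FiniteSums R
  open IntegerSolver R
  open QSeries R using (σ)
  open Slater R using (σ-+)
  open Algebra.Properties.Ring ring
  open Algebra.Properties.Semiring.Exp semiring using (_^_; ^-homo-*; ^-congʳ)
  open Relation.Binary.Reasoning.Setoid setoid

  ΣList : (List ℕ → Carrier) → List (List ℕ) → Carrier
  ΣList f []       = 0#
  ΣList f (l ∷ ls) = f l + ΣList f ls

  ΣList-cong : ∀ {f g} → (∀ l → f l ≈ g l) → ∀ ls → ΣList f ls ≈ ΣList g ls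
  ΣList-cong eq []       = refl
  ΣList-cong eq (l ∷ ls) = +-cong (eq l) (ΣList-cong eq ls)

  ΣList-*ˡ : ∀ a f ls → ΣList (λ l → a * f l) ls ≈ a * ΣList f ls
  ΣList-*ˡ a f []       = sym (zeroʳ a)
  ΣList-*ˡ a f (l ∷ ls) = trans (+-congˡ (ΣList-*ˡ a f ls)) (sym (distribˡ a _ _))

  ΣList-++ : ∀ f ls ls' → ΣList f (ls ++ ls') ≈ ΣList f ls + ΣList f ls'
  ΣList-++ f []       ls' = sym (+-identityˡ _)
  ΣList-++ f (l ∷ ls) ls' = trans (+-congˡ (ΣList-++ f ls ls')) (sym (+-assoc _ _ _))

  ΣList-map : ∀ f (h : List ℕ → List ℕ) ls → ΣList f (map h ls) ≈ ΣList (f ∘ h) ls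
  ΣList-map f h []       = refl
  ΣList-map f h (l ∷ ls) = +-congˡ (ΣList-map f h ls)

  [_] : Bool → Carrier
  [ true  ] = 1#
  [ false ] = 0#

  module Weighted (q : Carrier) where

    when : Bool → Carrier → Carrier
    when p x = if p then x else 0#

    signedPower : List ℕ → Carrier
    signedPower l = σ (oddParts l) * q ^ size l

    weight : List ℕ → Carrier
    weight l = when (inP4 l) (signedPower l)

    partWeight : ℕ → Carrier
    partWeight x = σ (if isOdd x then 1 else 0) * q ^ x

    -- headed b sums over the partitions with largest part b + 1; tails x b sums over what may follow a largest
    -- part x when the remaining parts are at most b.
    headed : ℕ → Carrier
    headed b = ΣList (weight ∘ (suc b ∷_)) (distinctParts≤ b)

    tails : ℕ → ℕ → Carrier
    tails x b = [ smallestOK x ] + Σ< b (λ i → [ consecutiveOK x (suc i) ] * headed i)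

    signedPower-∷ : ∀ x l → signedPower (x ∷ l) ≈ partWeight x * signedPower l
    signedPower-∷ x l = trans (*-cong (σ-+ (if isOdd x then 1 else 0) (oddParts l)) (^-homo-* q x (size l)))
      (solve 4 (λ a b c d → (a :* b) :* (c :* d) := (a :* c) :* (b :* d)) refl
        (σ (if isOdd x then 1 else 0)) (σ (oddParts l)) (q ^ x) (q ^ size l))

    when-∧ : ∀ p p' {s a b} → s ≈ a * b → when (p ∧ p') s ≈ a * ([ p ] * when p' b)
    when-∧ true  true  eq = trans eq (*-congˡ (sym (*-identityˡ _)))
    when-∧ true  false eq = trans (sym (zeroʳ _)) (*-congˡ (sym (zeroʳ _)))
    when-∧ false p'    eq = trans (sym (zeroʳ _)) (*-congˡ (sym (zeroˡ _)))

    weight-[] : weight [] ≈ 1#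
    weight-[] = *-identityˡ 1#

    weight-singleton : ∀ x → weight (suc x ∷ []) ≈ partWeight (suc x) * [ smallestOK (suc x) ]
    weight-singleton x = lemma (smallestOK (suc x)) (trans (signedPower-∷ (suc x) []) (trans (*-congˡ weight-[]) (*-identityʳ _)))
      where
      lemma : ∀ p {s a} → s ≈ a → when p s ≈ a * [ p ]
      lemma true  eq = trans eq (sym (*-identityʳ _))
      lemma false eq = sym (zeroʳ _)

    weight-∷∷ : ∀ x y l → weight (x ∷ y ∷ l) ≈ partWeight x * ([ consecutiveOK x y ] * weight (y ∷ l))
    weight-∷∷ x y l = when-∧ (consecutiveOK x y) (inP4 (y ∷ l)) (signedPower-∷ x (y ∷ l))

    Σ-distinctParts≤-suc : ∀ f b → ΣList f (distinctParts≤ (suc b))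
      ≈ ΣList f (distinctParts≤ b) + ΣList (f ∘ (suc b ∷_)) (distinctParts≤ b)
    Σ-distinctParts≤-suc f b = trans (ΣList-++ f (distinctParts≤ b) _) (+-congˡ (ΣList-map f (suc b ∷_) (distinctParts≤ b)))

    -- Membership in 𝒫₄ is a condition on adjacent parts, so the weight factors at the leading pair.
    -- Raising b adds exactly the lists whose second part is b + 1.
    weight-tails : ∀ x b → ΣList (weight ∘ (suc x ∷_)) (distinctParts≤ b) ≈ partWeight (suc x) * tails (suc x) b
    weight-tails x zero = begin
      weight (suc x ∷ []) + 0#                            ≈⟨ +-identityʳ _ ⟩
      weight (suc x ∷ [])                                 ≈⟨ weight-singleton x ⟩
      partWeight (suc x) * [ smallestOK (suc x) ]         ≈⟨ *-congˡ (+-identityʳ _) ⟨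
      partWeight (suc x) * tails (suc x) 0                ∎
    weight-tails x (suc b) = begin
      ΣList (weight ∘ (suc x ∷_)) (distinctParts≤ (suc b))
        ≈⟨ Σ-distinctParts≤-suc (weight ∘ (suc x ∷_)) b ⟩
      ΣList (weight ∘ (suc x ∷_)) (distinctParts≤ b) + ΣList (λ l → weight (suc x ∷ suc b ∷ l)) (distinctParts≤ b)
        ≈⟨ +-cong (weight-tails x b) (trans (ΣList-cong (weight-∷∷ (suc x) (suc b)) (distinctParts≤ b))
             (trans (ΣList-*ˡ s (λ l → κ * weight (suc b ∷ l)) (distinctParts≤ b))
               (*-congˡ (ΣList-*ˡ κ (weight ∘ (suc b ∷_)) (distinctParts≤ b))))) ⟩
      s * tails (suc x) b + s * (κ * headed b)
        ≈⟨ distribˡ s _ _ ⟨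
      s * (tails (suc x) b + κ * headed b)
        ≈⟨ *-congˡ (+-assoc _ _ _) ⟩
      s * tails (suc x) (suc b) ∎
      where
      s κ : Carrier
      s = partWeight (suc x)
      κ = [ consecutiveOK (suc x) (suc b) ]

    Σ-weight : ∀ b → ΣList weight (distinctParts≤ b) ≈ 1# + Σ< b headed
    Σ-weight zero    = +-congʳ weight-[]
    Σ-weight (suc b) = trans (Σ-distinctParts≤-suc weight b) (trans (+-congʳ (Σ-weight b)) (+-assoc _ _ _))

    completions : ℕ → Carrier
    completions b = tails (suc b) b

    headed≈ : ∀ b → headed b ≈ partWeight (suc b) * completions b
    headed≈ b = weight-tails b b

    [_]-cong : ∀ {p p'} → p ≡ p' → [ p ] ≈ [ p' ]
    [ eq ]-cong = reflexive (≡.cong [_] eq)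

    -- By periodicity, parts up to b may follow b + 5 exactly when they may follow b + 1. Only the
    -- candidates b + 1, ..., b + 4, at gaps 4, 3, 2, 1, are new.
    completions-4+ : ∀ b → completions (4 ℕ.+ b) ≈ completions b
      + ([ gapOK (isOdd (suc b)) (isOdd (1 ℕ.+ b)) 4 ] * headed b
      + ([ gapOK (isOdd (suc b)) (isOdd (2 ℕ.+ b)) 3 ] * headed (1 ℕ.+ b)
      + ([ gapOK (isOdd (suc b)) (isOdd (3 ℕ.+ b)) 2 ] * headed (2 ℕ.+ b)
      +  [ gapOK (isOdd (suc b)) (isOdd (4 ℕ.+ b)) 1 ] * headed (3 ℕ.+ b))))
    completions-4+ b = begin
      [ smallestOK (suc b) ] + ((((Σ< b (f 4) + f 4 b) + f 4 (1 ℕ.+ b)) + f 4 (2 ℕ.+ b)) + f 4 (3 ℕ.+ b))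
        ≈⟨ +-congˡ (+-cong (+-cong (+-cong (+-cong
             (Σ-cong< b (λ i<b → *-congʳ ([ consecutiveOK-4+ (s≤s i<b) ]-cong)))
             (*-congʳ [ consecutiveOK-+ 3 (1 ℕ.+ b) ]-cong))
             (*-congʳ [ consecutiveOK-+ 2 (2 ℕ.+ b) ]-cong))
             (*-congʳ [ consecutiveOK-+ 1 (3 ℕ.+ b) ]-cong))
             (*-congʳ [ consecutiveOK-+ 0 (4 ℕ.+ b) ]-cong)) ⟩
      [ smallestOK (suc b) ] + ((((Σ< b (f 0) + g₄) + g₃) + g₂) + g₁)
        ≈⟨ solve 6 (λ s x a b c d → s :+ ((((x :+ a) :+ b) :+ c) :+ d) := (s :+ x) :+ (a :+ (b :+ (c :+ d)))) refl
             [ smallestOK (suc b) ] (Σ< b (f 0)) g₄ g₃ g₂ g₁ ⟩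
      completions b + (g₄ + (g₃ + (g₂ + g₁))) ∎
      where
      f : ℕ → ℕ → Carrier
      f d i = [ consecutiveOK (d ℕ.+ suc b) (suc i) ] * headed i
      g₁ g₂ g₃ g₄ : Carrier
      g₄ = [ gapOK (isOdd (suc b)) (isOdd (1 ℕ.+ b)) 4 ] * headed b
      g₃ = [ gapOK (isOdd (suc b)) (isOdd (2 ℕ.+ b)) 3 ] * headed (1 ℕ.+ b)
      g₂ = [ gapOK (isOdd (suc b)) (isOdd (3 ℕ.+ b)) 2 ] * headed (2 ℕ.+ b)
      g₁ = [ gapOK (isOdd (suc b)) (isOdd (4 ℕ.+ b)) 1 ] * headed (3 ℕ.+ b)

    -- Of the four candidates after 2n + 5, the parts 2n + 2 (gap 3) and 2n + 3 (gap 2) are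
    -- admissible. After 2n + 6 the same two are, at gaps 4 and 3; hence an odd part and its even
    -- successor have equal completions.
    completions-4+-odd : ∀ n → completions (4 ℕ.+ n ℕ.* 2)
      ≈ completions (n ℕ.* 2) + (headed (1 ℕ.+ n ℕ.* 2) + headed (2 ℕ.+ n ℕ.* 2))
    completions-4+-odd n = trans (completions-4+ (n ℕ.* 2)) (+-congˡ
      (simplify (isOdd-odd n) (isOdd-even n)))
      where
      simplify : ∀ {o o' a b c d} → o ≡ true → o' ≡ false →
        [ gapOK o o 4 ] * a + ([ gapOK o o' 3 ] * b + ([ gapOK o o 2 ] * c + [ gapOK o o' 1 ] * d)) ≈ b + c
      simplify ≡.refl ≡.refl = solve 4 (λ a b c d → con 0ℤ :* a :+ (con 1ℤ :* b :+ (con 1ℤ :* c :+ con 0ℤ :* d)) := b :+ c) refl _ _ _ _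

    completions-4+-even : ∀ n → completions (5 ℕ.+ n ℕ.* 2)
      ≈ completions (1 ℕ.+ n ℕ.* 2) + (headed (1 ℕ.+ n ℕ.* 2) + headed (2 ℕ.+ n ℕ.* 2))
    completions-4+-even n = trans (completions-4+ (1 ℕ.+ n ℕ.* 2)) (+-congˡ
      (simplify (isOdd-even n) (isOdd-odd n)))
      where
      simplify : ∀ {o o' a b c d} → o ≡ false → o' ≡ true →
        [ gapOK o o 4 ] * a + ([ gapOK o o' 3 ] * b + ([ gapOK o o 2 ] * c + [ gapOK o o' 1 ] * d)) ≈ a + b
      simplify ≡.refl ≡.refl = solve 4 (λ a b c d → con 1ℤ :* a :+ (con 1ℤ :* b :+ (con 0ℤ :* c :+ con 0ℤ :* d)) := a :+ b) refl _ _ _ _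

    -- The common value of completions at the largest parts 2k+1 and 2k+2.
    L : ℕ → Carrier
    L 0             = 1#
    L 1             = - q
    L (suc (suc k)) = L k + (q ^ (2 ℕ.+ k ℕ.* 2) * L k + - (q ^ (3 ℕ.+ k ℕ.* 2) * L (suc k)))

    headed-odd : ∀ k → completions (k ℕ.* 2) ≈ L k → headed (k ℕ.* 2) ≈ - (q ^ (1 ℕ.+ k ℕ.* 2) * L k)
    headed-odd k eq = trans (headed≈ (k ℕ.* 2)) (trans (*-cong (simplify (isOdd-odd k)) eq) (sym (-‿distribˡ-* _ _)))
      where
      simplify : ∀ {o x} → o ≡ true → σ (if o then 1 else 0) * x ≈ - x
      simplify ≡.refl = solve 1 (λ x → (:- con 1ℤ :* con 1ℤ) :* x := :- x) refl _

    headed-even : ∀ k → completions (1 ℕ.+ k ℕ.* 2) ≈ L k → headed (1 ℕ.+ k ℕ.* 2) ≈ q ^ (2 ℕ.+ k ℕ.* 2) * L k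
    headed-even k eq = trans (headed≈ (1 ℕ.+ k ℕ.* 2)) (*-cong (simplify (isOdd-even k)) eq)
      where
      simplify : ∀ {o x} → o ≡ false → σ (if o then 1 else 0) * x ≈ x
      simplify ≡.refl = *-identityˡ _

    CompletionsAt : ℕ → Set ℓ
    CompletionsAt k = (completions (k ℕ.* 2) ≈ L k) × (completions (1 ℕ.+ k ℕ.* 2) ≈ L k)

    completions-step : ∀ k → CompletionsAt k → CompletionsAt (suc k) → CompletionsAt (suc (suc k))
    completions-step k (odd , even) (odd′ , _) =
        trans (completions-4+-odd k) (+-cong odd added)
      , trans (completions-4+-even k) (+-cong even added)
      where
      added : headed (1 ℕ.+ k ℕ.* 2) + headed (2 ℕ.+ k ℕ.* 2)
            ≈ q ^ (2 ℕ.+ k ℕ.* 2) * L k + - (q ^ (3 ℕ.+ k ℕ.* 2) * L (suc k))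
      added = +-cong (headed-even k even) (headed-odd (suc k) odd′)

    -- Nothing may follow 1 or 2, and both may be smallest parts. Neither 3 nor 4 may be smallest,
    -- and each can be followed only by 1, of weight - q.
    completions≈L : ∀ k → CompletionsAt k
    completions≈L 0 = +-identityʳ 1#
      , solve 1 (λ h → con 1ℤ :+ (con 0ℤ :+ con 0ℤ :* h) := con 1ℤ) refl (headed 0)
    completions≈L 1 =
        trans (solve 2 (λ h h' → con 0ℤ :+ ((con 0ℤ :+ con 1ℤ :* h) :+ con 0ℤ :* h') := h) refl (headed 0) (headed 1)) h₀
      , trans (solve 3 (λ h h' h'' → con 0ℤ :+ (((con 0ℤ :+ con 1ℤ :* h) :+ con 0ℤ :* h') :+ con 0ℤ :* h'') := h) refl
                (headed 0) (headed 1) (headed 2)) h₀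
      where
      h₀ : headed 0 ≈ - q
      h₀ = trans (headed-odd 0 (+-identityʳ 1#)) (solve 1 (λ q → :- ((q :* con 1ℤ) :* con 1ℤ) := :- q) refl q)
    completions≈L (suc (suc k)) = completions-step k (completions≈L k) (completions≈L (suc k))

    -- Truncations of G(z) = Σ_k L_k z^k at z = q^{2j}; G satisfies (1 - z²) G(z) = 1 - qz (1 - qz) G(q²z).
    G< : ℕ → ℕ → Carrier
    G< M j = Σ< M (λ k → q ^ (2 ℕ.* (j ℕ.* k)) * L k)

    -- In the recurrence for L_(k+2), multiplied by z^(k+2) and summed, the factors q^(2k) turn G(z)
    -- into G(q²z), while L_0 = 1 and L_1 = - q leave the constant 1. The last term is the exact
    -- error of the truncation at k < M; it carries z^M, which vanishes for j ≥ 1 and large M.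
    G<-equation : ∀ M j → (1# - q ^ (2 ℕ.* j) * q ^ (2 ℕ.* j)) * G< M j
      ≈ 1# - q * q ^ (2 ℕ.* j) * (1# - q * q ^ (2 ℕ.* j)) * G< M (suc j)
        - q ^ (2 ℕ.* (j ℕ.* M)) * (L M + q ^ (2 ℕ.* j) * (L (suc M) + q * q ^ (M ℕ.* 2) * L M))
    G<-equation zero j = trans (solve 2 (λ q z → (con 1ℤ :- z :* z) :* con 0ℤ
        := con 1ℤ :- q :* z :* (con 1ℤ :- q :* z) :* con 0ℤ :- con 1ℤ :* (con 1ℤ :+ z :* (:- q :+ q :* con 1ℤ :* con 1ℤ)))
        refl q (q ^ (2 ℕ.* j)))
      (+-congˡ (-‿cong (*-congʳ (^-congʳ q (≡.sym (≡.cong (2 ℕ.*_) (ℕ.*-zeroʳ j)))))))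
    G<-equation (suc M) j = begin
      (1# - z * z) * (G + Z * L M)
        ≈⟨ distribˡ _ _ _ ⟩
      (1# - z * z) * G + (1# - z * z) * (Z * L M)
        ≈⟨ +-congʳ (G<-equation M j) ⟩
      1# - q * z * (1# - q * z) * G' - Z * (L M + z * (L (suc M) + q * W * L M)) + (1# - z * z) * (Z * L M)
        ≈⟨ solve 7 (λ q z g' Z W l l' →
             con 1ℤ :- q :* z :* (con 1ℤ :- q :* z) :* g' :- Z :* (l :+ z :* (l' :+ q :* W :* l)) :+ (con 1ℤ :- z :* z) :* (Z :* l)
             := con 1ℤ :- q :* z :* (con 1ℤ :- q :* z) :* (g' :+ Z :* W :* l)
                :- Z :* z :* (l' :+ z :* ((l :+ (q :* (q :* W) :* l :+ :- (q :* (q :* (q :* W)) :* l'))) :+ q :* (q :* (q :* W)) :* l')))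
             refl q z G' Z W (L M) (L (suc M)) ⟩
      1# - q * z * (1# - q * z) * (G' + Z * W * L M) - Z * z * (L (suc M) + z * (L (suc (suc M)) + q * q ^ (suc M ℕ.* 2) * L (suc M)))
        ≈⟨ +-cong (+-congˡ (-‿cong (*-congˡ (+-congˡ (*-congʳ Z*W))))) (-‿cong (*-congʳ Z*z)) ⟩
      1# - q * z * (1# - q * z) * G< (suc M) (suc j)
        - q ^ (2 ℕ.* (j ℕ.* suc M)) * (L (suc M) + z * (L (suc (suc M)) + q * q ^ (suc M ℕ.* 2) * L (suc M))) ∎
      where
      z Z W G G' : Carrier
      z = q ^ (2 ℕ.* j)
      Z = q ^ (2 ℕ.* (j ℕ.* M))
      W = q ^ (M ℕ.* 2)
      G = G< M j
      G' = G< M (suc j)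
      index : ∀ j M → 2 ℕ.* (j ℕ.* M) ℕ.+ M ℕ.* 2 ≡ 2 ℕ.* (suc j ℕ.* M)
      index = solve-∀
      index' : ∀ j M → 2 ℕ.* (j ℕ.* M) ℕ.+ 2 ℕ.* j ≡ 2 ℕ.* (j ℕ.* suc M)
      index' = solve-∀
      Z*W : Z * W ≈ q ^ (2 ℕ.* (suc j ℕ.* M))
      Z*W = trans (sym (^-homo-* q (2 ℕ.* (j ℕ.* M)) (M ℕ.* 2))) (^-congʳ q (index j M))
      Z*z : Z * z ≈ q ^ (2 ℕ.* (j ℕ.* suc M))
      Z*z = trans (sym (^-homo-* q (2 ℕ.* (j ℕ.* M)) (2 ℕ.* j))) (^-congʳ q (index' j M))

    -- The largest parts 2k + 1 and 2k + 2 together contribute (q^(2k+2) - q^(2k+1)) L_k = - q (1 -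
    -- q) (q²)^k L_k.
    Σ-headed : ∀ M → Σ< (M ℕ.* 2) headed ≈ - (q * (1# - q)) * G< M 1
    Σ-headed zero    = sym (zeroʳ _)
    Σ-headed (suc M) = begin
      Σ< (M ℕ.* 2) headed + headed (M ℕ.* 2) + headed (1 ℕ.+ M ℕ.* 2)
        ≈⟨ +-cong (+-cong (Σ-headed M) (headed-odd M (proj₁ (completions≈L M)))) (headed-even M (proj₂ (completions≈L M))) ⟩
      - (q * (1# - q)) * G< M 1 + - (q * W * L M) + q * (q * W) * L M
        ≈⟨ solve 4 (λ q g w l → :- (q :* (con 1ℤ :- q)) :* g :+ :- (q :* w :* l) :+ q :* (q :* w) :* l
             := :- (q :* (con 1ℤ :- q)) :* (g :+ w :* l)) refl q (G< M 1) W (L M) ⟩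
      - (q * (1# - q)) * (G< M 1 + W * L M)
        ≈⟨ *-congˡ (+-congˡ (*-congʳ (^-congʳ q (index M)))) ⟩
      - (q * (1# - q)) * G< (suc M) 1 ∎
      where
      W : Carrier
      W = q ^ (M ℕ.* 2)
      index : ∀ M → M ℕ.* 2 ≡ 2 ℕ.* (1 ℕ.* M)
      index = solve-∀

    -- Iteration of the functional equation

    module _ (N : ℕ) (q^[1+N]≈0 : q ^ suc N ≈ 0#) where
      open QSeries.Truncated R q N q^[1+N]≈0
      open Slater.Identity R q N q^[1+N]≈0

      G : ℕ → Carrier
      G = G< (suc N)

      headed-vanish : ∀ k → headed (k ℕ.+ N) ≈ 0#
      headed-vanish k = trans (headed≈ (k ℕ.+ N)) (trans (*-congʳ (trans (*-congˡ (q^-vanish (s≤s (ℕ.m≤n+m N k)))) (zeroʳ _))) (zeroˡ _))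

      Σ-weight≈G : ΣList weight (distinctParts≤ N) ≈ 1# - q * (1# - q) * G 1
      Σ-weight≈G = begin
        ΣList weight (distinctParts≤ N)        ≈⟨ Σ-weight N ⟩
        -- Largest parts above N contribute zero, so the range can be enlarged to the even length
        -- 2(N + 1), in which 2k + 1 and 2k + 2 are paired.
        1# + Σ< N headed                       ≈⟨ +-congˡ (Σ-extend N (2 ℕ.+ N) headed-vanish) ⟨
        1# + Σ< (2 ℕ.+ N ℕ.+ N) headed         ≈⟨ +-congˡ (reflexive (≡.cong (λ n → Σ< n headed) (index N))) ⟩
        1# + Σ< (suc N ℕ.* 2) headed           ≈⟨ +-congˡ (Σ-headed (suc N)) ⟩
        1# + - (q * (1# - q)) * G 1            ≈⟨ +-congˡ (-‿distribˡ-* _ _) ⟨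
        1# - q * (1# - q) * G 1                ∎
        where
        index : ∀ N → 2 ℕ.+ N ℕ.+ N ≡ suc N ℕ.* 2
        index = solve-∀

      G-equation : ∀ n → factor (4 ℕ.+ 4 ℕ.* n) * G (suc n)
        ≈ 1# - q ^ (3 ℕ.+ 2 ℕ.* n) * (1# - q ^ (3 ℕ.+ 2 ℕ.* n)) * G (suc (suc n))
      G-equation n = begin
        factor (4 ℕ.+ 4 ℕ.* n) * G (suc n)
          ≈⟨ *-congʳ (+-congˡ (-‿cong (q^-≡* (2 ℕ.* suc n) (2 ℕ.* suc n) (index n)))) ⟩
        (1# - z * z) * G (suc n)
          ≈⟨ G<-equation (suc N) (suc n) ⟩
        1# - q * z * (1# - q * z) * G (suc (suc n)) - q ^ (2 ℕ.* (suc n ℕ.* suc N)) * rest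
          ≈⟨ +-congˡ (-‿cong (*-congʳ (q^-vanish N<))) ⟩
        1# - q * z * (1# - q * z) * G (suc (suc n)) - 0# * rest
          ≈⟨ solve 2 (λ x r → x :- con 0ℤ :* r := x) refl _ rest ⟩
        1# - q * z * (1# - q * z) * G (suc (suc n))
          ≈⟨ +-congˡ (-‿cong (*-congʳ (*-cong qz (+-congˡ (-‿cong qz))))) ⟩
        1# - q ^ (3 ℕ.+ 2 ℕ.* n) * (1# - q ^ (3 ℕ.+ 2 ℕ.* n)) * G (suc (suc n)) ∎
        where
        z rest : Carrier
        z = q ^ (2 ℕ.* suc n)
        rest = L (suc N) + z * (L (suc (suc N)) + q * q ^ (suc N ℕ.* 2) * L (suc N))
        index : ∀ n → 4 ℕ.+ 4 ℕ.* n ≡ 2 ℕ.* suc n ℕ.+ 2 ℕ.* suc n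
        index = solve-∀
        N< : N ℕ.< 2 ℕ.* (suc n ℕ.* suc N)
        N< = ℕ.≤-trans (ℕ.m≤m+n (suc N) (n ℕ.* suc N)) (ℕ.m≤n*m (suc n ℕ.* suc N) 2)
        qz : q * z ≈ q ^ (3 ℕ.+ 2 ℕ.* n)
        qz = *-congˡ (^-congʳ q (ℕ.*-suc 2 n))

      -- The new denominator factor 1 - q^(4n+4) is the one that `G-equation` attaches to
      -- `G (suc n)`, so each use of that equation turns the remainder into the next summand and a
      -- new remainder.
      summand-suc : ∀ n → summand (suc n) * factor (4 ℕ.+ 4 ℕ.* n)
        ≈ summand n * - (q ^ (1 ℕ.+ 2 ℕ.* n) * (1# - q ^ (1 ℕ.+ 2 ℕ.* n)))
      summand-suc n = begin
        (O n * (1# - y)) * ((- 1# * σ n) * q ^ (suc n ℕ.* suc n)) * (J n * factor⁻¹ k) * factor k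
          ≈⟨ *-congʳ (*-congʳ (*-congˡ (*-congˡ (q^-≡* (n ℕ.* n) (1 ℕ.+ 2 ℕ.* n) (square n))))) ⟩
        (O n * (1# - y)) * ((- 1# * σ n) * (q ^ (n ℕ.* n) * y)) * (J n * factor⁻¹ k) * factor k
          ≈⟨ solve 7 (λ o y s x j i f → (o :* (con 1ℤ :- y)) :* ((:- con 1ℤ :* s) :* (x :* y)) :* (j :* i) :* f
               := (o :* (s :* x) :* j :* :- (y :* (con 1ℤ :- y))) :* (f :* i)) refl
               (O n) y (σ n) (q ^ (n ℕ.* n)) (J n) (factor⁻¹ k) (factor k) ⟩
        (summand n * - (y * (1# - y))) * (factor k * factor⁻¹ k)
          ≈⟨ *-congˡ (factor-inverse (3 ℕ.+ 4 ℕ.* n)) ⟩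
        (summand n * - (y * (1# - y))) * 1#
          ≈⟨ *-identityʳ _ ⟩
        summand n * - (y * (1# - y)) ∎
        where
        k : ℕ
        k = 4 ℕ.+ 4 ℕ.* n
        y : Carrier
        y = q ^ (1 ℕ.+ 2 ℕ.* n)
        square : ∀ n → suc n ℕ.* suc n ≡ n ℕ.* n ℕ.+ (1 ℕ.+ 2 ℕ.* n)
        square = solve-∀

      y : ℕ → Carrier
      y n = q ^ (1 ℕ.+ 2 ℕ.* n)

      -- The invariant of the iteration: n + 1 summands have been split off, and the remainder is a
      -- multiple of G at z = q^(2n+2).
      weight-expansion : ∀ n → ΣList weight (distinctParts≤ N)
        ≈ Σ< (suc n) summand + summand n * - (y n * (1# - y n)) * G (suc n)
      weight-expansion zero = trans Σ-weight≈G
        (solve 2 (λ q g → con 1ℤ :- q :* (con 1ℤ :- q) :* g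
           := (con 0ℤ :+ c₀) :+ c₀ :* :- ((q :* con 1ℤ) :* (con 1ℤ :- (q :* con 1ℤ))) :* g) refl q (G 1))
        where
        c₀ = con 1ℤ :* (con 1ℤ :* con 1ℤ) :* con 1ℤ
      weight-expansion (suc n) = begin
        ΣList weight (distinctParts≤ N)
          ≈⟨ weight-expansion n ⟩
        Σ< (suc n) summand + summand n * - (y n * (1# - y n)) * G (suc n)
          ≈⟨ +-congˡ (*-congʳ (summand-suc n)) ⟨
        Σ< (suc n) summand + summand (suc n) * factor (4 ℕ.+ 4 ℕ.* n) * G (suc n)
          ≈⟨ +-congˡ (trans (*-assoc _ _ _) (*-congˡ (G-equation n))) ⟩
        Σ< (suc n) summand + summand (suc n) * (1# - y' * (1# - y') * G (suc (suc n)))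
          ≈⟨ solve 4 (λ s t y g → s :+ t :* (con 1ℤ :- y :* (con 1ℤ :- y) :* g) := (s :+ t) :+ t :* :- (y :* (con 1ℤ :- y)) :* g)
               refl (Σ< (suc n) summand) (summand (suc n)) y' (G (suc (suc n))) ⟩
        Σ< (suc (suc n)) summand + summand (suc n) * - (y' * (1# - y')) * G (suc (suc n))
          ≈⟨ +-congˡ (*-congʳ (*-congˡ (-‿cong (*-cong y'≈ (+-congˡ (-‿cong y'≈)))))) ⟩
        Σ< (suc (suc n)) summand + summand (suc n) * - (y (suc n) * (1# - y (suc n))) * G (suc (suc n)) ∎
        where
        y' : Carrier
        y' = q ^ (3 ℕ.+ 2 ℕ.* n)
        y'≈ : y' ≈ y (suc n)
        y'≈ = ^-congʳ q (≡.cong suc (≡.sym (ℕ.*-suc 2 n)))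

      Σ-weight≈Σ-summand : ΣList weight (distinctParts≤ N) ≈ Σ< (suc N) summand
      Σ-weight≈Σ-summand = begin
        ΣList weight (distinctParts≤ N)
          ≈⟨ weight-expansion N ⟩
        Σ< (suc N) summand + summand N * - (y N * (1# - y N)) * G (suc N)
          -- The remainder carries q^(2N+1), which is zero.
          ≈⟨ +-congˡ (*-congʳ (*-congˡ (-‿cong (*-congʳ (q^-vanish (s≤s (ℕ.m≤m+n N (N ℕ.+ 0)))))))) ⟩
        Σ< (suc N) summand + summand N * - (0# * (1# - y N)) * G (suc N)
          ≈⟨ solve 4 (λ s c y g → s :+ c :* :- (con 0ℤ :* (con 1ℤ :- y)) :* g := s) refl
               (Σ< (suc N) summand) (summand N) (y N) (G (suc N)) ⟩
        Σ< (suc N) summand ∎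

-- Truncated power series

module PowerSeries where
  open ≡ using (refl; sym; trans; cong; cong₂; module ≡-Reasoning)
  open ≡-Reasoning

  sumBelow-cong : ∀ n {f g} → (∀ {k} → k ℕ.< n → f k ≡ g k) → sumBelow n f ≡ sumBelow n g
  sumBelow-cong zero    eq = refl
  sumBelow-cong (suc n) eq = cong₂ ℤ._+_ (sumBelow-cong n (λ k<n → eq (ℕ.m<n⇒m<1+n k<n))) (eq ℕ.≤-refl)

  sumBelow-front : ∀ n f → sumBelow (suc n) f ≡ f 0 ℤ.+ sumBelow n (f ∘ suc)
  sumBelow-front zero    f = ℤ.+-comm 0ℤ (f 0)
  sumBelow-front (suc n) f = trans (cong (ℤ._+ f (suc n)) (sumBelow-front n f)) (ℤ.+-assoc (f 0) _ _)

  sumBelow-+ : ∀ n f g → sumBelow n (λ k → f k ℤ.+ g k) ≡ sumBelow n f ℤ.+ sumBelow n g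
  sumBelow-+ zero    f g = refl
  sumBelow-+ (suc n) f g = trans (cong (ℤ._+ (f n ℤ.+ g n)) (sumBelow-+ n f g)) (interchange (sumBelow n f) (sumBelow n g) (f n) (g n))
    where
    interchange : ∀ a b c d → a ℤ.+ b ℤ.+ (c ℤ.+ d) ≡ a ℤ.+ c ℤ.+ (b ℤ.+ d)
    interchange = ℤRing.solve-∀

  sumBelow-*ˡ : ∀ n c f → sumBelow n (λ k → c ℤ.* f k) ≡ c ℤ.* sumBelow n f
  sumBelow-*ˡ zero    c f = sym (ℤ.*-zeroʳ c)
  sumBelow-*ˡ (suc n) c f = trans (cong (ℤ._+ c ℤ.* f n) (sumBelow-*ˡ n c f)) (sym (ℤ.*-distribˡ-+ c _ _))

  sumBelow-extend : ∀ m n {f} → (∀ k → f (k ℕ.+ m) ≡ 0ℤ) → sumBelow (n ℕ.+ m) f ≡ sumBelow m f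
  sumBelow-extend m zero    eq = refl
  sumBelow-extend m (suc n) eq = trans (cong₂ ℤ._+_ (sumBelow-extend m n eq) (eq n)) (ℤ.+-identityʳ _)

  ⊛-cong : ∀ {f f' g g'} n → (∀ {k} → k ℕ.≤ n → f k ≡ f' k) → (∀ {k} → k ℕ.≤ n → g k ≡ g' k) → (f ⊛ g) n ≡ (f' ⊛ g') n
  ⊛-cong n eq eq' = sumBelow-cong (suc n) (λ { {k} (s≤s k≤n) → cong₂ ℤ._*_ (eq k≤n) (eq' (ℕ.m∸n≤m n k)) })

  -- This is f = f 0 + q (f ∘ suc) multiplied by g. Together with its mirror image `⊛-sucʳ` it
  -- yields commutativity and associativity by induction on the coefficient, without reindexing
  -- double sums.
  ⊛-sucˡ : ∀ f g n → (f ⊛ g) (suc n) ≡ f 0 ℤ.* g (suc n) ℤ.+ ((f ∘ suc) ⊛ g) n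
  ⊛-sucˡ f g n = sumBelow-front (suc n) (λ k → f k ℤ.* g (suc n ∸ k))

  ⊛-sucʳ : ∀ f g n → (f ⊛ g) (suc n) ≡ (f ⊛ (g ∘ suc)) n ℤ.+ f (suc n) ℤ.* g 0
  ⊛-sucʳ f g n = cong₂ ℤ._+_
    (sumBelow-cong (suc n) (λ { {k} (s≤s k≤n) → cong (λ m → f k ℤ.* g m) (ℕ.+-∸-assoc 1 k≤n) }))
    (cong (λ m → f (suc n) ℤ.* g m) (ℕ.n∸n≡0 n))

  ⊛-scaleˡ : ∀ c f g n → (scale c f ⊛ g) n ≡ c ℤ.* (f ⊛ g) n
  ⊛-scaleˡ c f g n = trans (sumBelow-cong (suc n) (λ {k} _ → ℤ.*-assoc c (f k) (g (n ∸ k))))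
    (sumBelow-*ˡ (suc n) c _)

  ⊛-distribʳ : ∀ h f g n → ((f ⊕ g) ⊛ h) n ≡ (f ⊛ h) n ℤ.+ (g ⊛ h) n
  ⊛-distribʳ h f g n = trans (sumBelow-cong (suc n) (λ {k} _ → ℤ.*-distribʳ-+ (h (n ∸ k)) (f k) (g k)))
    (sumBelow-+ (suc n) _ _)

  ⊛-comm : ∀ f g n → (f ⊛ g) n ≡ (g ⊛ f) n
  ⊛-comm f g zero    = cong (λ x → 0ℤ ℤ.+ x) (ℤ.*-comm (f 0) (g 0))
  ⊛-comm f g (suc n) = begin
    (f ⊛ g) (suc n)                                ≡⟨ ⊛-sucˡ f g n ⟩
    f 0 ℤ.* g (suc n) ℤ.+ ((f ∘ suc) ⊛ g) n        ≡⟨ cong₂ ℤ._+_ (ℤ.*-comm (f 0) _) (⊛-comm (f ∘ suc) g n) ⟩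
    g (suc n) ℤ.* f 0 ℤ.+ (g ⊛ (f ∘ suc)) n        ≡⟨ ℤ.+-comm (g (suc n) ℤ.* f 0) _ ⟩
    (g ⊛ (f ∘ suc)) n ℤ.+ g (suc n) ℤ.* f 0        ≡⟨ ⊛-sucʳ g f n ⟨
    (g ⊛ f) (suc n)                                ∎

  ⊛-assoc : ∀ f g h n → ((f ⊛ g) ⊛ h) n ≡ (f ⊛ (g ⊛ h)) n
  ⊛-assoc f g h zero    = constant (f 0) (g 0) (h 0)
    where
    constant : ∀ a b c → 0ℤ ℤ.+ (0ℤ ℤ.+ a ℤ.* b) ℤ.* c ≡ 0ℤ ℤ.+ a ℤ.* (0ℤ ℤ.+ b ℤ.* c)
    constant = ℤRing.solve-∀
  ⊛-assoc f g h (suc n) = begin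
    ((f ⊛ g) ⊛ h) (suc n)
      ≡⟨ ⊛-sucˡ (f ⊛ g) h n ⟩
    (0ℤ ℤ.+ f 0 ℤ.* g 0) ℤ.* h (suc n) ℤ.+ (((f ⊛ g) ∘ suc) ⊛ h) n
      ≡⟨ cong (λ x → (0ℤ ℤ.+ f 0 ℤ.* g 0) ℤ.* h (suc n) ℤ.+ x) (⊛-cong {g = h} n (λ {k} _ → ⊛-sucˡ f g k) (λ _ → refl)) ⟩
    (0ℤ ℤ.+ f 0 ℤ.* g 0) ℤ.* h (suc n) ℤ.+ ((scale (f 0) (g ∘ suc) ⊕ ((f ∘ suc) ⊛ g)) ⊛ h) n
      ≡⟨ cong (λ x → (0ℤ ℤ.+ f 0 ℤ.* g 0) ℤ.* h (suc n) ℤ.+ x) (trans (⊛-distribʳ h (scale (f 0) (g ∘ suc)) ((f ∘ suc) ⊛ g) n)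
           (cong₂ ℤ._+_ (⊛-scaleˡ (f 0) (g ∘ suc) h n) (⊛-assoc (f ∘ suc) g h n))) ⟩
    (0ℤ ℤ.+ f 0 ℤ.* g 0) ℤ.* h (suc n) ℤ.+ (f 0 ℤ.* ((g ∘ suc) ⊛ h) n ℤ.+ ((f ∘ suc) ⊛ (g ⊛ h)) n)
      ≡⟨ regroup (f 0) (g 0) (h (suc n)) (((g ∘ suc) ⊛ h) n) (((f ∘ suc) ⊛ (g ⊛ h)) n) ⟩
    f 0 ℤ.* (g 0 ℤ.* h (suc n) ℤ.+ ((g ∘ suc) ⊛ h) n) ℤ.+ ((f ∘ suc) ⊛ (g ⊛ h)) n
      ≡⟨ cong (λ x → f 0 ℤ.* x ℤ.+ ((f ∘ suc) ⊛ (g ⊛ h)) n) (⊛-sucˡ g h n) ⟨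
    f 0 ℤ.* (g ⊛ h) (suc n) ℤ.+ ((f ∘ suc) ⊛ (g ⊛ h)) n
      ≡⟨ ⊛-sucˡ f (g ⊛ h) n ⟨
    (f ⊛ (g ⊛ h)) (suc n) ∎
    where
    regroup : ∀ a b c x y → (0ℤ ℤ.+ a ℤ.* b) ℤ.* c ℤ.+ (a ℤ.* x ℤ.+ y) ≡ a ℤ.* (b ℤ.* c ℤ.+ x) ℤ.+ y
    regroup = ℤRing.solve-∀

  ⊛-zeroˡ : ∀ {f} g n → (∀ k → f k ≡ 0ℤ) → (f ⊛ g) n ≡ 0ℤ
  ⊛-zeroˡ {f} g n eq = trans (sumBelow-cong (suc n) (λ {k} _ → trans (cong (ℤ._* g (n ∸ k)) (eq k)) (sym (ℤ.*-zeroˡ 0ℤ))))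
    (trans (sumBelow-*ˡ (suc n) 0ℤ (λ _ → 0ℤ)) (ℤ.*-zeroˡ (sumBelow (suc n) (λ _ → 0ℤ))))

  ⊛-identityˡ : ∀ f n → (one ⊛ f) n ≡ f n
  ⊛-identityˡ f zero    = trans (ℤ.+-identityˡ _) (ℤ.*-identityˡ (f 0))
  ⊛-identityˡ f (suc n) = trans (⊛-sucˡ one f n)
    (trans (cong₂ ℤ._+_ (ℤ.*-identityˡ (f (suc n))) (⊛-zeroˡ f n (λ _ → refl))) (ℤ.+-identityʳ _))

  mon-suc : ∀ n k → mon (suc n) k ≡ (mon 1 ⊛ mon n) k
  mon-suc n zero    = refl
  mon-suc n (suc k) = sym (trans (⊛-sucˡ (mon 1) (mon n) k)
    (trans (cong₂ ℤ._+_ (ℤ.*-zeroˡ (mon n (suc k))) (⊛-identityˡ (mon n) k)) (ℤ.+-identityˡ _)))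

  mon-< : ∀ {n k} → k ℕ.< n → mon n k ≡ 0ℤ
  mon-< {suc n} {zero}  _         = refl
  mon-< {suc n} {suc k} (s≤s k<n) = mon-< k<n

  -- ℤ[[q]]/(q^{N+1})
  truncated : ℕ → CommutativeRing 0ℓ 0ℓ
  truncated N = record
    { Carrier = Series
    ; _≈_ = λ f g → ∀ {k} → k ℕ.≤ N → f k ≡ g k
    ; _+_ = _⊕_
    ; _*_ = _⊛_
    ; -_  = λ f k → ℤ.- f k
    ; 0#  = λ _ → 0ℤ
    ; 1#  = one
    ; isCommutativeRing = record
      { isRing = record
        { +-isAbelianGroup = record
          { isGroup = record
            { isMonoid = record
              { isSemigroup = record
                { isMagma = record
                  { isEquivalence = record
                    { refl = λ _ → refl
                    ; sym = λ eq k≤N → sym (eq k≤N)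
                    ; trans = λ eq eq' k≤N → trans (eq k≤N) (eq' k≤N)
                    }
                  ; ∙-cong = λ eq eq' k≤N → cong₂ ℤ._+_ (eq k≤N) (eq' k≤N)
                  }
                ; assoc = λ f g h {k} _ → ℤ.+-assoc (f k) (g k) (h k)
                }
              ; identity = (λ f {k} _ → ℤ.+-identityˡ (f k)) , (λ f {k} _ → ℤ.+-identityʳ (f k))
              }
            ; inverse = (λ f {k} _ → ℤ.+-inverseˡ (f k)) , (λ f {k} _ → ℤ.+-inverseʳ (f k))
            ; ⁻¹-cong = λ eq k≤N → cong ℤ.-_ (eq k≤N)
            }
          ; comm = λ f g {k} _ → ℤ.+-comm (f k) (g k)
          }
        ; *-cong = λ eq eq' {k} k≤N → ⊛-cong k (λ j≤k → eq (ℕ.≤-trans j≤k k≤N)) (λ j≤k → eq' (ℕ.≤-trans j≤k k≤N))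
        ; *-assoc = λ f g h {k} _ → ⊛-assoc f g h k
        ; *-identity = (λ f {k} _ → ⊛-identityˡ f k) , (λ f {k} _ → trans (⊛-comm f one k) (⊛-identityˡ f k))
        ; distrib = (λ h f g {k} _ → trans (⊛-comm h (f ⊕ g) k) (trans (⊛-distribʳ h f g k)
                      (cong₂ ℤ._+_ (⊛-comm f h k) (⊛-comm g h k))))
                  , (λ h f g {k} _ → ⊛-distribʳ h f g k)
        }
      ; *-comm = λ f g {k} _ → ⊛-comm f g k
      }
    }

open PowerSeries

-- From the truncated ring back to coefficients

module Coefficients (N : ℕ) where
  open CommutativeRing (truncated N)
  open FiniteSums (truncated N)
  open QSeries (truncated N)
  open Algebra.Properties.Semiring.Exp semiring using (_^_)

  q : Series
  q = mon 1

  q^≈mon : ∀ n → q ^ n ≈ mon n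
  q^≈mon zero    = refl {one}
  q^≈mon (suc n) = trans (*-congˡ {q} {q ^ n} {mon n} (q^≈mon n)) (λ {k} _ → ≡.sym (mon-suc n k))

  q^[1+N]≈0 : q ^ suc N ≈ 0#
  q^[1+N]≈0 = trans (q^≈mon (suc N)) (λ k≤N → mon-< (s≤s k≤N))

  open Truncated q N q^[1+N]≈0

  Σ<-coefficient : ∀ n f k → Σ< n f k ≡ sumBelow n (λ j → f j k)
  Σ<-coefficient zero    f k = ≡.refl
  Σ<-coefficient (suc n) f k = ≡.cong (ℤ._+ f n k) (Σ<-coefficient n f k)

  oneMinus≈factor : ∀ m → oneMinus m ≈ factor m
  oneMinus≈factor m {k} k≤N = ≡.cong (λ x → one k ℤ.- x) (≡.sym (q^≈mon m k≤N))

  -- `geo` stops at j = k and `factor⁻¹` at j = N; the terms in between have exponent (m + 1) j > k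
  -- and do not reach the coefficient of q^k.
  geo≈factor⁻¹ : ∀ m → geo (suc m) ≈ factor⁻¹ (suc m)
  geo≈factor⁻¹ m {k} k≤N = begin
    sumBelow (suc k) (λ j → mon (suc m ℕ.* j) k)
      ≡⟨ sumBelow-extend (suc k) (N ∸ k) (λ j → mon-< (ℕ.≤-trans (ℕ.m≤n+m (suc k) j) (ℕ.m≤m+n (j ℕ.+ suc k) _))) ⟨
    sumBelow (N ∸ k ℕ.+ suc k) (λ j → mon (suc m ℕ.* j) k)
      ≡⟨ ≡.cong (λ n → sumBelow n (λ j → mon (suc m ℕ.* j) k)) (≡.trans (ℕ.+-suc (N ∸ k) k) (≡.cong suc (ℕ.m∸n+n≡m k≤N))) ⟩
    sumBelow (suc N) (λ j → mon (suc m ℕ.* j) k)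
      ≡⟨ sumBelow-cong (suc N) (λ {j} _ → q^≈mon (suc m ℕ.* j) k≤N) ⟨
    sumBelow (suc N) (λ j → (q ^ (suc m ℕ.* j)) k)
      ≡⟨ Σ<-coefficient (suc N) (λ j → q ^ (suc m ℕ.* j)) k ⟨
    factor⁻¹ (suc m) k ∎
    where open ≡.≡-Reasoning

  prodList≈Π : ∀ (h : ℕ → Series) (g : ℕ → ℕ) n → prodList (map h (applyUpTo g n)) ≈ Π< n (h ∘ g)
  prodList≈Π h g zero    = refl {one}
  prodList≈Π h g (suc n) = trans
    (*-congˡ {h (g 0)} {prodList (map h (applyUpTo (g ∘ suc) n))} {Π< n (h ∘ g ∘ suc)} (prodList≈Π h (g ∘ suc) n))
    (sym {Π< (suc n) (h ∘ g)} (Π-front n (h ∘ g)))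

  poch≈pochhammer : ∀ a d n → poch a d n ≈ pochhammer a d n
  poch≈pochhammer a d n = trans (prodList≈Π (λ i → oneMinus (a ℕ.+ d ℕ.* i)) id n)
    (Π-cong n {λ i → oneMinus (a ℕ.+ d ℕ.* i)} {λ i → factor (a ℕ.+ d ℕ.* i)} (λ i → oneMinus≈factor (a ℕ.+ d ℕ.* i)))

  invPoch≈pochhammer⁻¹ : ∀ a d n → invPoch (suc a) d n ≈ pochhammer⁻¹ (suc a) d n
  invPoch≈pochhammer⁻¹ a d n = trans (prodList≈Π (λ i → geo (suc a ℕ.+ d ℕ.* i)) id n)
    (Π-cong n {λ i → geo (suc a ℕ.+ d ℕ.* i)} {λ i → factor⁻¹ (suc a ℕ.+ d ℕ.* i)} (λ i → geo≈factor⁻¹ (a ℕ.+ d ℕ.* i)))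

  poch-stable : ∀ a d n → poch (suc a) (suc d) (n ℕ.+ N) ≈ poch (suc a) (suc d) N
  poch-stable a d n = trans (poch≈pochhammer (suc a) (suc d) (n ℕ.+ N))
    (trans (pochhammer-stable a d n) (sym {poch (suc a) (suc d) N} (poch≈pochhammer (suc a) (suc d) N)))

  invPoch-stable : ∀ a d n → invPoch (suc a) (suc d) (n ℕ.+ N) ≈ invPoch (suc a) (suc d) N
  invPoch-stable a d n = trans (invPoch≈pochhammer⁻¹ a (suc d) (n ℕ.+ N))
    (trans (pochhammer⁻¹-stable a d n) (sym {invPoch (suc a) (suc d) N} (invPoch≈pochhammer⁻¹ a (suc d) N)))

  σ≈negOnePow : ∀ n → σ n ≈ scale (negOnePow n) one
  σ≈negOnePow zero    {k} _ = ≡.sym (ℤ.*-identityˡ (one k))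
  σ≈negOnePow (suc n) {k} k≤N = begin
    ((- 1#) ⊛ σ n) k
      ≡⟨ ⊛-cong k (λ {j} _ → ≡.sym (ℤ.-1*i≡-i (one j))) (λ j≤k → σ≈negOnePow n (ℕ.≤-trans j≤k k≤N)) ⟩
    (scale ℤ.-1ℤ one ⊛ scale (negOnePow n) one) k
      ≡⟨ ⊛-scaleˡ ℤ.-1ℤ one (scale (negOnePow n) one) k ⟩
    ℤ.-1ℤ ℤ.* (one ⊛ scale (negOnePow n) one) k
      ≡⟨ ≡.cong (ℤ.-1ℤ ℤ.*_) (⊛-identityˡ (scale (negOnePow n) one) k) ⟩
    ℤ.-1ℤ ℤ.* (negOnePow n ℤ.* one k)
      ≡⟨ ℤ.-1*i≡-i (negOnePow n ℤ.* one k) ⟩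
    ℤ.- (negOnePow n ℤ.* one k)
      ≡⟨ ℤ.neg-distribˡ-* (negOnePow n) (one k) ⟩
    negOnePow (suc n) ℤ.* one k ∎
    where open ≡.≡-Reasoning

  σ*q^≈scale : ∀ n m → σ n * q ^ m ≈ scale (negOnePow n) (mon m)
  σ*q^≈scale n m = trans (*-cong {σ n} {scale (negOnePow n) one} {q ^ m} {mon m} (σ≈negOnePow n) (q^≈mon m))
    (λ {k} _ → ≡.trans (⊛-scaleˡ (negOnePow n) one (mon m) k) (≡.cong (negOnePow n ℤ.*_) (⊛-identityˡ (mon m) k)))

-- A list sum is determined by its two defining equations; this gives access to a summation known
-- only through them.
foldr-unique : ∀ {A : Set} (c : A → ℤ) (S : List A → ℤ) →
  S [] ≡ 0ℤ → (∀ x xs → S (x ∷ xs) ≡ c x ℤ.+ S xs) →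
  ∀ xs → S xs ≡ foldr (λ x s → c x ℤ.+ s) 0ℤ xs
foldr-unique c S S[] S∷ []       = S[]
foldr-unique c S S[] S∷ (x ∷ xs) = ≡.trans (S∷ x xs) (≡.cong (λ s → c x ℤ.+ s) (foldr-unique c S S[] S∷ xs))

foldr-filter : ∀ {A : Set} (p : A → Bool) (c : A → ℤ) xs →
  foldr (λ x s → c x ℤ.+ s) 0ℤ (filterᵇ p xs) ≡ foldr (λ x s → (if p x then c x else 0ℤ) ℤ.+ s) 0ℤ xs
foldr-filter p c []       = ≡.refl
foldr-filter p c (x ∷ xs) with p x
... | true  = ≡.cong (λ s → c x ℤ.+ s) (foldr-filter p c xs)
... | false = ≡.trans (foldr-filter p c xs) (≡.sym (ℤ.+-identityˡ _))

-- The summation in P4Series is a local function that cannot be named from outside, so it is recovered by unification.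
mutual
  sumList : ℕ → List (List ℕ) → ℤ
  sumList = _

  P4Series-foldr : ∀ N → P4Series N ≡ foldr (λ l s → negOnePow (oddParts l) ℤ.+ s) 0ℤ
    (filterᵇ (λ l → (size l ≡ᵇ N) ∧ inP4 l) (distinctParts≤ N))
  P4Series-foldr N with filterᵇ (λ l → (size l ≡ᵇ N) ∧ inP4 l) (distinctParts≤ N)
  ... | ls = foldr-unique (negOnePow ∘ oddParts) (sumList N) ≡.refl (λ _ _ → ≡.refl) ls

module Comparison (N : ℕ) where
  open CommutativeRing (truncated N)
  open FiniteSums (truncated N)
  open QSeries (truncated N)
  open Coefficients N
  open Truncated q N q^[1+N]≈0
  open Slater.Identity (truncated N) q N q^[1+N]≈0
  open Partitions (truncated N)
  open Weighted q
  open Algebra.Properties.Semiring.Exp semiring using (_^_)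

  -- The number of factors in `pochInf` depends on the coefficient k that is read. Stability is
  -- therefore applied in the ring truncated at k, where k + 1, k and N factors agree at q^k.
  pochInf≈pochhammer : ∀ a d → pochInf (suc a) (suc d) ≈ pochhammer (suc a) (suc d) N
  pochInf≈pochhammer a d {k} k≤N = begin
    poch (suc a) (suc d) (suc k) k        ≡⟨ Coefficients.poch-stable k a d 1 ℕ.≤-refl ⟩
    poch (suc a) (suc d) k k              ≡⟨ Coefficients.poch-stable k a d (N ∸ k) ℕ.≤-refl ⟨
    poch (suc a) (suc d) (N ∸ k ℕ.+ k) k  ≡⟨ ≡.cong (λ n → poch (suc a) (suc d) n k) (ℕ.m∸n+n≡m k≤N) ⟩
    poch (suc a) (suc d) N k              ≡⟨ poch≈pochhammer (suc a) (suc d) N k≤N ⟩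
    pochhammer (suc a) (suc d) N k        ∎
    where open ≡.≡-Reasoning

  invPochInf≈pochhammer⁻¹ : ∀ a d → invPochInf (suc a) (suc d) ≈ pochhammer⁻¹ (suc a) (suc d) N
  invPochInf≈pochhammer⁻¹ a d {k} k≤N = begin
    invPoch (suc a) (suc d) (suc k) k        ≡⟨ Coefficients.invPoch-stable k a d 1 ℕ.≤-refl ⟩
    invPoch (suc a) (suc d) k k              ≡⟨ Coefficients.invPoch-stable k a d (N ∸ k) ℕ.≤-refl ⟨
    invPoch (suc a) (suc d) (N ∸ k ℕ.+ k) k  ≡⟨ ≡.cong (λ n → invPoch (suc a) (suc d) n k) (ℕ.m∸n+n≡m k≤N) ⟩
    invPoch (suc a) (suc d) N k              ≡⟨ invPoch≈pochhammer⁻¹ a (suc d) N k≤N ⟩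
    pochhammer⁻¹ (suc a) (suc d) N k         ∎
    where open ≡.≡-Reasoning

  productSeries≈ : productSeries ≈
    pochhammer 1 6 N * (pochhammer 5 6 N * (pochhammer 6 12 N * (pochhammer 6 12 N *
    (pochhammer⁻¹ 2 6 N * (pochhammer⁻¹ 3 6 N * pochhammer⁻¹ 4 6 N)))))
  productSeries≈ =
    *-cong {pochInf 1 6} {u = pochInf 5 6 ⊛ tail₄} (pochInf≈pochhammer 0 5)
    (*-cong {pochInf 5 6} {u = tail₄} (pochInf≈pochhammer 4 5)
    (*-cong {pochInf 6 12} {u = pochInf 6 12 ⊛ tail₂} (pochInf≈pochhammer 5 11)
    (*-cong {pochInf 6 12} {u = tail₂} (pochInf≈pochhammer 5 11)
    (*-cong {invPochInf 2 6} {u = invPochInf 3 6 ⊛ invPochInf 4 6} (invPochInf≈pochhammer⁻¹ 1 5)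
    (*-cong {invPochInf 3 6} {u = invPochInf 4 6} (invPochInf≈pochhammer⁻¹ 2 5) (invPochInf≈pochhammer⁻¹ 3 5))))))
    where
    tail₂ tail₄ : Series
    tail₂ = invPochInf 2 6 ⊛ (invPochInf 3 6 ⊛ invPochInf 4 6)
    tail₄ = pochInf 6 12 ⊛ (pochInf 6 12 ⊛ tail₂)

  middle-term : ℕ → Series
  middle-term n = poch 1 2 n ⊛ (scale (negOnePow n) (mon (n ℕ.* n)) ⊛ invPoch 4 4 n)

  middle-term≈summand : ∀ n → middle-term n ≈ summand n
  middle-term≈summand n = trans
    (*-cong {u = m ⊛ invPoch 4 4 n} {v = (σ n * q ^ (n ℕ.* n)) * J n} (poch≈pochhammer 1 2 n)
      (*-cong {x = m} (sym {σ n * q ^ (n ℕ.* n)} {m} (σ*q^≈scale n (n ℕ.* n))) (invPoch≈pochhammer⁻¹ 3 4 n)))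
    (sym {summand n} (*-assoc (O n) (σ n * q ^ (n ℕ.* n)) (J n)))
    where
    m : Series
    m = scale (negOnePow n) (mon (n ℕ.* n))

  middleSeries≡ : middleSeries N ≡ Σ< (suc N) summand N
  middleSeries≡ = ≡.trans (sumBelow-cong (suc N) (λ {n} _ → middle-term≈summand n ℕ.≤-refl))
    (≡.sym (Σ<-coefficient (suc N) summand N))

  contribution : List ℕ → ℤ
  contribution l = if (size l ≡ᵇ N) ∧ inP4 l then negOnePow (oddParts l) else 0ℤ

  -- The filter on `size` is what taking the coefficient of q^N does to a signed power of q with
  -- exponent `size l`.
  weight-coefficient : ∀ l → weight l N ≡ contribution l
  weight-coefficient l = coefficient (inP4 l) (size l) (σ*q^≈scale (oddParts l) (size l) ℕ.≤-refl)
    where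
    indicator : ∀ b c → c ℤ.* (if b then 1ℤ else 0ℤ) ≡ (if b then c else 0ℤ)
    indicator true  = ℤ.*-identityʳ
    indicator false = ℤ.*-zeroʳ
    coefficient : ∀ p n {s c} → s N ≡ c ℤ.* mon n N → when p s N ≡ (if (n ≡ᵇ N) ∧ p then c else 0ℤ)
    coefficient true  n {c = c} eq = ≡.trans eq (≡.trans (indicator (n ≡ᵇ N) c)
      (≡.cong (λ b → if b then c else 0ℤ) (≡.sym (∧-identityʳ (n ≡ᵇ N)))))
    coefficient false n {c = c} eq = ≡.cong (λ b → if b then c else 0ℤ) (≡.sym (∧-zeroʳ (n ≡ᵇ N)))

  Σ-contribution : ∀ ls → foldr (λ l x → contribution l ℤ.+ x) 0ℤ ls ≡ ΣList weight ls N
  Σ-contribution []       = ≡.refl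
  Σ-contribution (l ∷ ls) = ≡.cong₂ ℤ._+_ (≡.sym (weight-coefficient l)) (Σ-contribution ls)

  P4Series≡ : P4Series N ≡ ΣList weight (distinctParts≤ N) N
  P4Series≡ = ≡.trans (P4Series-foldr N)
    (≡.trans (foldr-filter (λ l → (size l ≡ᵇ N) ∧ inP4 l) (negOnePow ∘ oddParts) (distinctParts≤ N))
      (Σ-contribution (distinctParts≤ N)))

theorem3p7 : (N : ℕ) → (P4Series N ≡ middleSeries N) × (middleSeries N ≡ productSeries N)
theorem3p7 N =
    ≡.trans P4Series≡ (≡.trans (Σ-weight≈Σ-summand N q^[1+N]≈0 ℕ.≤-refl) (≡.sym middleSeries≡))
  , ≡.trans middleSeries≡ (≡.trans (Σ-summand≈product ℕ.≤-refl) (≡.sym (productSeries≈ ℕ.≤-refl)))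
  where
  open Comparison N
  open Coefficients N using (q; q^[1+N]≈0)
  open Slater.Identity (truncated N) q N q^[1+N]≈0 using (Σ-summand≈product)
  open Partitions.Weighted (truncated N) q using (Σ-weight≈Σ-summand)
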